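{- The sets $\mathcal{B}_{\mathrm{FPF}}(x)^{ -1}=\{u^{ -1}:u\in\mathcal{B}_{\mathrm{FPF}}(x)\}$, for $x$ ranging over the fixed-point-free involutions in $S_{2n}$, are exactly the distinct equivalence classes of $S_{2n}$ under $\sim_{\mathcal{B}_{\mathrm{FPF}}}$ (permutations identified with one-line sequences).
   Context: $S_{2n}$ has simple generators $s_i=(i,i+1)$ and length $\ell$. The Demazure product $\circ$ is the unique associative operation on $S_{2n}$ with $s\circ w = sw$ if $\ell(sw)>\ell(w)$ and $s\circ w=w$ otherwise, and $w\circ s=ws$ if $\ell(ws)>\ell(w)$ and $w\circ s = w$ otherwise. Let $w_{\mathrm{fpf}}=s_1s_3\cdots s_{2n-1}$ and $\mathcal{B}_{\mathrm{FPF}}(x)=\{w\in S_{2n}: w^{ -1}\circ w_{\mathrm{fpf}}\circ w=x\}$. The relation $\sim_{\mathcal{B}_{\mathrm{FPF}}}$ is the smallest equivalence relation on integer sequences of length $2n$ such that: (i) for any $a,b$, a sequence with $a,b$ in positions $2i-1,2i$ is equivalent to the sequence with these two entries swapped, all other entries equal; (ii) for $a\le b\le c\le d$, sequences which agree outside positions $2i-1,2i,2i+1,2i+2$ and have in those positions respectively $[a,d,b,c]$, $[b,c,a,d]$, $[b,d,a,c]$, $[c,d,a,b]$ are all equivalent. -}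

module Defs where

open import Data.Bool using (Bool; true; false; if_then_else_)
open import Data.Nat using (ℕ; zero; suc; _+_; _*_; _≡ᵇ_; _<ᵇ_; _<_; _≤_)
open import Data.Integer as ℤ using (ℤ; +_)
open import Data.List using (List; []; _∷_; map; upTo; length; foldr; filterᵇ; _++_)
open import Data.List.Relation.Unary.All using (All)
open import Data.List.Relation.Binary.Permutation.Propositional using (_↭_)
open import Data.Product using (Σ; ∃; _×_; _,_)
open import Relation.Binary.PropositionalEquality using (_≡_; _≢_)
open import Relation.Binary.Construct.Closure.Equivalence using (EqClosure)

-- Permutations of {1,…,m} in one-line notation: w ↦ [w(1), …, w(m)].

oneTo : ℕ → List ℕ
oneTo m = map suc (upTo m)

IsPerm : ℕ → List ℕ → Set
IsPerm m w = w ↭ oneTo m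

at : List ℕ → ℕ → ℕ
at []       j             = j
at (x ∷ xs) zero          = zero
at (x ∷ xs) (suc zero)    = x
at (x ∷ xs) (suc (suc j)) = at xs (suc j)

_·_ : List ℕ → List ℕ → List ℕ
u · w = map (at u) w

pos : List ℕ → ℕ → ℕ
pos []       j = zero
pos (x ∷ xs) j = if x ≡ᵇ j then 1 else suc (pos xs j)

inv : List ℕ → List ℕ
inv w = map (pos w) (oneTo (length w))

idp : ℕ → List ℕ
idp m = oneTo m

swapNum : ℕ → ℕ → ℕ
swapNum k x = if x ≡ᵇ k then suc k else (if x ≡ᵇ suc k then k else x)

s : ℕ → ℕ → List ℕ
s m k = map (swapNum k) (oneTo m)

-- Coxeter length = number of inversions
ℓ : List ℕ → ℕ
ℓ []       = zero
ℓ (x ∷ xs) = length (filterᵇ (λ y → y <ᵇ x) xs) + ℓ xs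

demL : ℕ → ℕ → List ℕ → List ℕ
demL m k w = if ℓ w <ᵇ ℓ (s m k · w) then s m k · w else w

prod : ℕ → List ℕ → List ℕ
prod m []       = idp m
prod m (k ∷ ks) = s m k · prod m ks

act : ℕ → List ℕ → List ℕ → List ℕ
act m ks w = foldr (demL m) w ks

ReducedWord : ℕ → List ℕ → List ℕ → Set
ReducedWord m u ks =
  All (λ k → 1 ≤ k × k < m) ks × prod m ks ≡ u × length ks ≡ ℓ u

-- Demazure product: u ∘ w ≡ z  (computed as s_{k1} ∘ ⋯ ∘ s_{kr} ∘ w
-- for a reduced word k1 ⋯ kr of u, which is forced by associativity)
Dem : ℕ → List ℕ → List ℕ → List ℕ → Set
Dem m u w z = Σ (List ℕ) λ ks → ReducedWord m u ks × act m ks w ≡ z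

wfpf : ℕ → List ℕ
wfpf n = prod (2 * n) (map (λ i → suc (2 * i)) (upTo n))

BFPF : ℕ → List ℕ → List ℕ → Set
BFPF n x w = IsPerm (2 * n) w ×
  Σ (List ℕ) λ y → Dem (2 * n) (wfpf n) w y × Dem (2 * n) (inv w) y x

FPFInvolution : ℕ → List ℕ → Set
FPFInvolution n x = IsPerm (2 * n) x × x · x ≡ idp (2 * n) ×
  (∀ j → 1 ≤ j → j ≤ 2 * n → at x j ≢ j)

-- The relation ∼_{B_FPF} on integer sequences (0-based prefixes of even
-- length correspond to positions 2i-1, 2i, … in 1-based indexing).

data Pattern (a b c d : ℤ) : List ℤ → Set where
  p1 : Pattern a b c d (a ∷ d ∷ b ∷ c ∷ [])
  p2 : Pattern a b c d (b ∷ c ∷ a ∷ d ∷ [])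
  p3 : Pattern a b c d (b ∷ d ∷ a ∷ c ∷ [])
  p4 : Pattern a b c d (c ∷ d ∷ a ∷ b ∷ [])

data Step : List ℤ → List ℤ → Set where
  swap : ∀ (pre suf : List ℤ) (k : ℕ) → length pre ≡ 2 * k → ∀ a b →
         Step (pre ++ a ∷ b ∷ suf) (pre ++ b ∷ a ∷ suf)
  quad : ∀ (pre suf : List ℤ) (k : ℕ) → length pre ≡ 2 * k →
         ∀ a b c d → a ℤ.≤ b → b ℤ.≤ c → c ℤ.≤ d →
         ∀ p q → Pattern a b c d p → Pattern a b c d q →
         Step (pre ++ p ++ suf) (pre ++ q ++ suf)

_∼B_ : List ℤ → List ℤ → Set
_∼B_ = EqClosure Step

seq : List ℕ → List ℤ
seq w = map +_ w

{-# OPTIONS --safe #-}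
-- Write v = w⁻¹. The left and right Demazure actions of simple reflections
-- commute, so for a reduced word k₁ ⋯ kᵣ of v the element w⁻¹ ∘ w_fpf ∘ w is
-- s_{k₁} ⋆ (⋯ (s_{kᵣ} ⋆ w_fpf)) with s ⋆ z = s ∘ z ∘ s, and it depends on v
-- alone. A generating step of ∼ changes v on positions 2i−1, …, 2i+2, that is,
-- the end of a suitable reduced word, where the value is unchanged by a
-- computation in S₄. Conversely, every even sequence without repetitions is
-- equivalent to a canonical one a₁ b₁ a₂ b₂ … with aᵢ < bᵢ and a₁ < a₂ < ⋯.
-- Canonical permutations are closed under going down in the left weak order,
-- and along a reduced word of a canonical v each ⋆ is a genuine conjugation, so
-- the value at v is the involution exchanging every aᵢ with bᵢ, which determines v.
module Submission where

open import Defs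
open import Data.Bool using (true; false; if_then_else_; T)
import Data.Integer as ℤ
import Data.Integer.Properties as ℤ
open import Data.List using (List; []; _∷_; _++_; [_]; map; length; foldr; filterᵇ; upTo; applyUpTo)
open import Data.List.Membership.Propositional using (_∈_)
open import Data.List.Membership.Propositional.Properties using (∈-map⁺; ∈-∃++)
open import Data.List.Properties
  using (map-++; length-map; length-++; map-id; map-∘; map-cong; map-cong-local; foldr-++; ++-assoc; map-injective; ∷-injective)
open import Data.List.Relation.Binary.Equality.Propositional using (≋⇒≡)
open import Data.List.Relation.Binary.Permutation.Propositional
  using (_↭_; ↭-sym; ↭-trans; ↭-refl; ↭-reflexive; prep; swap; ↭⇒↭ₛ)
open import Data.List.Relation.Binary.Permutation.Propositional.Properties
  using (↭-length; All-resp-↭; ∈-resp-↭; drop-∷; ++⁺ˡ; ++⁺ʳ; ++-comm; shift) renaming (map⁺ to ↭-map⁺)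
import Data.List.Relation.Binary.Permutation.Setoid.Properties as ↭ₛ
open import Data.List.Relation.Unary.All as All using (All; []; _∷_)
import Data.List.Relation.Unary.All.Properties as All
open import Data.List.Relation.Unary.AllPairs as AllPairs using (AllPairs; []; _∷_)
open import Data.List.Relation.Unary.Any using (here; there)
open import Data.List.Relation.Unary.Linked using (Linked; []; [-]; _∷_)
open import Data.List.Relation.Unary.Linked.Properties using (AllPairs⇒Linked)
open import Data.List.Relation.Unary.Sorted.TotalOrder.Properties using (↗↭↗⇒≋)
open import Data.List.Relation.Unary.Unique.Propositional using (Unique)
import Data.List.Relation.Unary.Unique.Propositional.Properties as Unique
open import Data.Nat using (ℕ; zero; suc; _+_; _*_; _∸_; _<_; _≤_; _<ᵇ_; _≡ᵇ_; _≟_; z≤n; s≤s; _<?_)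
open import Data.Nat.Properties
open import Data.Product using (Σ; ∃; _×_; _,_; proj₁; proj₂)
open import Data.Sum using (_⊎_; inj₁; inj₂)
open import Data.Unit using (tt)
open import Function using (_∘_; id)
open import Relation.Binary using (tri<; tri≈; tri>)
open import Relation.Binary.Construct.Closure.Equivalence using (gmap; return; symmetric)
open import Relation.Binary.Construct.Closure.ReflexiveTransitive using (ε; _◅_; _◅◅_)
open import Relation.Binary.Construct.Closure.Symmetric using (SymClosure; fwd; bwd)
open import Relation.Binary.PropositionalEquality hiding ([_])
open import Relation.Nullary using (¬_; yes; no; contradiction)

-- Transpositions of values and positions

-- `Dem` asks for some reduced word without saying which, so a value means nothing until it is known
-- not to depend on the word. Braid relations are avoided altogether. Any permutation is a word of
-- right actions applied to the identity, and right actions pass through left ones, so a left word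
-- is determined by its effect on the identity. The same exchange produces the two-sided action: w =
-- v⁻¹ is built from the identity by right actions along the letters of v, and these move past w_fpf
-- to pair up with the left letters. Two-sided actions lose information whenever a letter is idle,
-- so an equality of values cannot be undone letter by letter. This is why canonical representatives
-- are needed: no letter is idle along them, and the value still shows the pairs. Length tests are
-- awkward in inductions over lists. They are replaced by the order of occurrence of two consecutive
-- values, which a scan of the list decides.

≡ᵇ-true : ∀ {x y} → x ≡ y → (x ≡ᵇ y) ≡ true
≡ᵇ-true {x} {y} eq with x ≡ᵇ y | ≡⇒≡ᵇ x y eq
... | true | _ = refl

≡ᵇ-false : ∀ {x y} → x ≢ y → (x ≡ᵇ y) ≡ false
≡ᵇ-false {x} {y} ne with x ≡ᵇ y in eq
... | false = refl
... | true  = contradiction (≡ᵇ⇒≡ x y (subst T (sym eq) tt)) ne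

<ᵇ-true : ∀ {x y} → x < y → (x <ᵇ y) ≡ true
<ᵇ-true {x} {y} lt with x <ᵇ y | <⇒<ᵇ lt
... | true | _ = refl

<ᵇ-false : ∀ {x y} → ¬ x < y → (x <ᵇ y) ≡ false
<ᵇ-false {x} {y} nlt with x <ᵇ y in eq
... | false = refl
... | true  = contradiction (<ᵇ⇒< x y (subst T (sym eq) tt)) nlt

<ᵇ-cong : ∀ {a b c d} → (a < b → c < d) → (c < d → a < b) → (c <ᵇ d) ≡ (a <ᵇ b)
<ᵇ-cong {a} {b} f g with a <? b
... | yes a<b = trans (<ᵇ-true (f a<b)) (sym (<ᵇ-true a<b))
... | no  a≮b = trans (<ᵇ-false (a≮b ∘ g)) (sym (<ᵇ-false a≮b))

swapNum-l : ∀ k → swapNum k k ≡ suc k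
swapNum-l k rewrite ≡ᵇ-true {k} refl = refl

swapNum-r : ∀ k → swapNum k (suc k) ≡ k
swapNum-r k rewrite ≡ᵇ-false {suc k} {k} 1+n≢n | ≡ᵇ-true {k} refl = refl

swapNum-o : ∀ {k x} → x ≢ k → x ≢ suc k → swapNum k x ≡ x
swapNum-o x≢k x≢sk rewrite ≡ᵇ-false x≢k | ≡ᵇ-false x≢sk = refl

data View (k : ℕ) : ℕ → Set where
  isL : View k k
  isR : View k (suc k)
  isO : ∀ {x} → x ≢ k → x ≢ suc k → View k x

view : ∀ k x → View k x
view k x with x ≟ k | x ≟ suc k
... | yes refl | _        = isL
... | no _     | yes refl = isR
... | no p     | no q     = isO p q

swapNum-involutive : ∀ k x → swapNum k (swapNum k x) ≡ x
swapNum-involutive k x with view k x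
... | isL rewrite swapNum-l k = swapNum-r k
... | isR rewrite swapNum-r k = swapNum-l k
... | isO p q rewrite swapNum-o p q = swapNum-o p q

swapNum-injective : ∀ k {x y} → swapNum k x ≡ swapNum k y → x ≡ y
swapNum-injective k {x} {y} eq =
  trans (sym (swapNum-involutive k x)) (trans (cong (swapNum k) eq) (swapNum-involutive k y))

swapNum-≡l : ∀ {k x} → swapNum k x ≡ k → x ≡ suc k
swapNum-≡l {k} eq = swapNum-injective k (trans eq (sym (swapNum-r k)))

swapNum-≡r : ∀ {k x} → swapNum k x ≡ suc k → x ≡ k
swapNum-≡r {k} eq = swapNum-injective k (trans eq (sym (swapNum-l k)))

-- No number lies strictly between `k` and `suc k`, so only this one pair can change its order.
swapNum-mono : ∀ k {a b} → a < b → (a ≡ k → b ≢ suc k) → swapNum k a < swapNum k b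
swapNum-mono k {a} {b} a<b h with view k a | view k b
... | isL | isL = contradiction a<b (<-irrefl refl)
... | isL | isR = contradiction refl (h refl)
... | isL | isO p q rewrite swapNum-l k | swapNum-o p q = ≤∧≢⇒< a<b (q ∘ sym)
... | isR | isL = contradiction a<b (<-asym (n<1+n k))
... | isR | isR = contradiction a<b (<-irrefl refl)
... | isR | isO p q rewrite swapNum-r k | swapNum-o p q = <-trans (n<1+n k) a<b
... | isO p q | isL rewrite swapNum-l k | swapNum-o p q = <-trans a<b (n<1+n k)
... | isO p q | isR rewrite swapNum-r k | swapNum-o p q = ≤∧≢⇒< (≤-pred a<b) p
... | isO p q | isO p′ q′ rewrite swapNum-o p q | swapNum-o p′ q′ = a<b

swapNum-<ᵇ : ∀ k {a b} → (a ≡ k → b ≢ suc k) → (a ≡ suc k → b ≢ k) →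
             (swapNum k a <ᵇ swapNum k b) ≡ (a <ᵇ b)
swapNum-<ᵇ k {a} {b} h h′ = <ᵇ-cong (λ lt → swapNum-mono k lt h)
  (λ lt → subst₂ _<_ (swapNum-involutive k a) (swapNum-involutive k b)
    (swapNum-mono k lt λ p q → h′ (swapNum-≡l p) (swapNum-≡r q)))

map-swapNum-involutive : ∀ k l → map (swapNum k) (map (swapNum k) l) ≡ l
map-swapNum-involutive k l = trans (sym (map-∘ l)) (trans (map-cong (swapNum-involutive k) l) (map-id l))

-- Without one of the two values, a list contains no pair that `swapNum k` reverses, so every
-- comparison of its entries survives the relabelling.
Lacks : ℕ → List ℕ → Set
Lacks k l = All (_≢ k) l ⊎ All (_≢ suc k) l

Lacks-tail : ∀ {k x l} → Lacks k (x ∷ l) → Lacks k l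
Lacks-tail (inj₁ (_ ∷ h)) = inj₁ h
Lacks-tail (inj₂ (_ ∷ h)) = inj₂ h

Lacks-<ᵇ : ∀ {k a b l} → Lacks k (a ∷ b ∷ l) → (swapNum k a <ᵇ swapNum k b) ≡ (a <ᵇ b)
Lacks-<ᵇ {k} (inj₁ (p ∷ q ∷ _)) = swapNum-<ᵇ k (λ e → contradiction e p) (λ _ → q)
Lacks-<ᵇ {k} (inj₂ (p ∷ q ∷ _)) = swapNum-<ᵇ k (λ _ → q) (λ e → contradiction e p)

map-swapNum-fix : ∀ {k l} → All (_≢ k) l → All (_≢ suc k) l → map (swapNum k) l ≡ l
map-swapNum-fix [] [] = refl
map-swapNum-fix (p ∷ ps) (q ∷ qs) = cong₂ _∷_ (swapNum-o p q) (map-swapNum-fix ps qs)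

-- The Demazure action s_k ∘ w of a value transposition, decided by which of
-- k, k + 1 is met first.
up : ℕ → List ℕ → List ℕ
up k []       = []
up k (x ∷ xs) = if x ≡ᵇ k then suc k ∷ map (swapNum k) xs
                else (if x ≡ᵇ suc k then x ∷ xs else x ∷ up k xs)

up-l : ∀ k xs → up k (k ∷ xs) ≡ suc k ∷ map (swapNum k) xs
up-l k xs rewrite ≡ᵇ-true {k} refl = refl

up-r : ∀ k xs → up k (suc k ∷ xs) ≡ suc k ∷ xs
up-r k xs rewrite ≡ᵇ-false {suc k} {k} 1+n≢n | ≡ᵇ-true {k} refl = refl

up-o : ∀ {k x} → x ≢ k → x ≢ suc k → ∀ xs → up k (x ∷ xs) ≡ x ∷ up k xs
up-o p q xs rewrite ≡ᵇ-false p | ≡ᵇ-false q = refl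

-- Right multiplication by s_i, with positions counted from one. Index zero and positions past the
-- end act trivially.
swapAt : ℕ → List ℕ → List ℕ
swapAt zero          l           = l
swapAt (suc i)       []          = []
swapAt (suc zero)    (a ∷ [])    = a ∷ []
swapAt (suc zero)    (a ∷ b ∷ l) = b ∷ a ∷ l
swapAt (suc (suc i)) (a ∷ l)     = a ∷ swapAt (suc i) l

-- The Demazure action w ∘ s_k on positions k, k + 1.
demR : ℕ → List ℕ → List ℕ
demR zero          l           = l
demR (suc i)       []          = []
demR (suc zero)    (a ∷ [])    = a ∷ []
demR (suc zero)    (a ∷ b ∷ l) = if a <ᵇ b then b ∷ a ∷ l else a ∷ b ∷ l
demR (suc (suc i)) (a ∷ l)     = a ∷ demR (suc i) l

map-swapAt : ∀ f i l → map f (swapAt i l) ≡ swapAt i (map f l)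
map-swapAt f zero          l           = refl
map-swapAt f (suc i)       []          = refl
map-swapAt f (suc zero)    (a ∷ [])    = refl
map-swapAt f (suc zero)    (a ∷ b ∷ l) = refl
map-swapAt f (suc (suc i)) (a ∷ l)     = cong (f a ∷_) (map-swapAt f (suc i) l)

map-demR : ∀ k i l → Lacks k l → map (swapNum k) (demR i l) ≡ demR i (map (swapNum k) l)
map-demR k zero          l           h = refl
map-demR k (suc i)       []          h = refl
map-demR k (suc zero)    (a ∷ [])    h = refl
map-demR k (suc zero)    (a ∷ b ∷ l) h rewrite Lacks-<ᵇ h with a <ᵇ b
... | true  = refl
... | false = refl
map-demR k (suc (suc i)) (a ∷ l)     h = cong (swapNum k a ∷_) (map-demR k (suc i) l (Lacks-tail h))

All-≢-sym : ∀ {x : ℕ} {l} → All (x ≢_) l → All (_≢ x) l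
All-≢-sym = All.map (λ p → p ∘ sym)

-- The actions interfere only where the two positions hold `k` and `suc k`; either of them then
-- leaves `suc k` in front and the other is idle. A third value compares with `k` as it does with
-- `suc k`, so all other tests agree. If `k` stands before the two positions, the tail is merely
-- relabelled and lacks `k`.
up-demR-comm : ∀ k i {l} → Unique l → up k (demR i l) ≡ demR i (up k l)
up-demR-comm k zero {l} _ = refl
up-demR-comm k (suc i) {[]} _ = refl
up-demR-comm k (suc zero) {a ∷ []} _ with view k a
... | isL rewrite up-l k [] = refl
... | isR rewrite up-r k [] = refl
... | isO p q rewrite up-o p q [] = refl
up-demR-comm k (suc zero) {a ∷ b ∷ l} ((a≢b ∷ a≢) ∷ b≢ ∷ _) with view k a | view k b
... | isL | isL = contradiction refl a≢b
... | isR | isR = contradiction refl a≢b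
... | isL | isR rewrite <ᵇ-true (n<1+n k) | up-r k (k ∷ l) | up-l k (suc k ∷ l) | swapNum-r k
                      | <ᵇ-false (<-asym (n<1+n k))
                      | map-swapNum-fix {k} (All-≢-sym a≢) (All-≢-sym b≢) = refl
... | isR | isL rewrite <ᵇ-false (<-asym (n<1+n k)) | up-r k (k ∷ l) | <ᵇ-false (<-asym (n<1+n k)) = refl
... | isL | isO p q rewrite up-l k (b ∷ l) | swapNum-o p q
                          | <ᵇ-cong {k} {b} {suc k} {b} (λ lt → ≤∧≢⇒< lt (q ∘ sym)) (<-trans (n<1+n k)) with k <ᵇ b
...   | true  rewrite up-o p q (k ∷ l) | up-l k l = refl
...   | false rewrite up-l k (b ∷ l) | swapNum-o p q = refl
up-demR-comm k (suc zero) {a ∷ b ∷ l} _ | isR | isO p q rewrite up-r k (b ∷ l) with suc k <ᵇ b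
...   | true  rewrite up-o p q (suc k ∷ l) | up-r k l = refl
...   | false rewrite up-r k (b ∷ l) = refl
up-demR-comm k (suc zero) {a ∷ b ∷ l} _ | isO p q | isL rewrite up-o p q (k ∷ l) | up-l k l
                          | <ᵇ-cong {a} {k} {a} {suc k} (λ lt → <-trans lt (n<1+n k)) (λ lt → ≤∧≢⇒< (≤-pred lt) p) with a <ᵇ k
...   | true  rewrite up-l k (a ∷ l) | swapNum-o p q = refl
...   | false rewrite up-o p q (k ∷ l) | up-l k l = refl
up-demR-comm k (suc zero) {a ∷ b ∷ l} _ | isO p q | isR rewrite up-o p q (suc k ∷ l) | up-r k l with a <ᵇ suc k
...   | true  rewrite up-r k (a ∷ l) = refl
...   | false rewrite up-o p q (suc k ∷ l) | up-r k l = refl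
up-demR-comm k (suc zero) {a ∷ b ∷ l} _ | isO p q | isO p′ q′ rewrite up-o p q (b ∷ l) | up-o p′ q′ l with a <ᵇ b
...   | true  rewrite up-o p′ q′ (a ∷ l) | up-o p q l = refl
...   | false rewrite up-o p q (b ∷ l) | up-o p′ q′ l = refl
up-demR-comm k (suc (suc i)) {a ∷ l} (a≢ ∷ u) with view k a
... | isL rewrite up-l k (demR (suc i) l) | up-l k l = cong (suc k ∷_) (map-demR k (suc i) l (inj₁ (All-≢-sym a≢)))
... | isR rewrite up-r k (demR (suc i) l) | up-r k l = refl
... | isO p q rewrite up-o p q (demR (suc i) l) | up-o p q l = cong (a ∷_) (up-demR-comm k (suc i) u)

-- Inversions, positions and inverses

cnt : ℕ → List ℕ → ℕ
cnt x xs = length (filterᵇ (λ y → y <ᵇ x) xs)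

cnt-∷ : ∀ x y ys → cnt x (y ∷ ys) ≡ (if y <ᵇ x then suc (cnt x ys) else cnt x ys)
cnt-∷ x y ys with y <ᵇ x
... | true  = refl
... | false = refl

cnt-map : ∀ k {x l} → (∀ {y} → y ∈ l → (swapNum k y <ᵇ swapNum k x) ≡ (y <ᵇ x)) →
          cnt (swapNum k x) (map (swapNum k) l) ≡ cnt x l
cnt-map k {x} {[]} h = refl
cnt-map k {x} {y ∷ l} h
  rewrite cnt-∷ (swapNum k x) (swapNum k y) (map (swapNum k) l) | cnt-∷ x y l
        | h (here refl) | cnt-map k {x} {l} (h ∘ there) = refl

cnt-map-o : ∀ {k x l} → x ≢ k → x ≢ suc k → cnt x (map (swapNum k) l) ≡ cnt x l
cnt-map-o {k} {x} {l} p q = subst (λ z → cnt z (map (swapNum k) l) ≡ cnt x l) (swapNum-o p q)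
  (cnt-map k {x} {l} (λ _ → swapNum-<ᵇ k (λ _ → q) (λ _ → p)))

cnt-map-Lacks : ∀ {k x l} → Lacks k (x ∷ l) → cnt (swapNum k x) (map (swapNum k) l) ≡ cnt x l
cnt-map-Lacks {k} {x} {l} (inj₁ (p ∷ h)) = cnt-map k {x} {l} λ y∈ →
  swapNum-<ᵇ k (λ e → contradiction e (All.lookup h y∈)) (λ _ → p)
cnt-map-Lacks {k} {x} {l} (inj₂ (p ∷ h)) = cnt-map k {x} {l} λ y∈ →
  swapNum-<ᵇ k (λ _ → p) (λ e → contradiction e (All.lookup h y∈))

ℓ-map-Lacks : ∀ {k l} → Lacks k l → ℓ (map (swapNum k) l) ≡ ℓ l
ℓ-map-Lacks {k} {[]} h = refl
ℓ-map-Lacks {k} {x ∷ l} h = cong₂ _+_ (cnt-map-Lacks h) (ℓ-map-Lacks (Lacks-tail h))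

-- Exactly one entry is newly counted: the old `suc k`, relabelled `k`.
cnt-map-l : ∀ {k l} → Unique l → All (k ≢_) l → suc k ∈ l →
            cnt (suc k) (map (swapNum k) l) ≡ suc (cnt k l)
cnt-map-l {k} {_ ∷ l} (s≢ ∷ _) (_ ∷ k≢) (here refl)
  rewrite swapNum-r k | cnt-∷ (suc k) k (map (swapNum k) l) | <ᵇ-true (n<1+n k)
        | cnt-∷ k (suc k) l | <ᵇ-false (<-asym (n<1+n k))
        | map-swapNum-fix {k} (All-≢-sym k≢) (All-≢-sym s≢) = cong suc (go l (All-≢-sym k≢))
  where
  go : ∀ l → All (_≢ k) l → cnt (suc k) l ≡ cnt k l
  go []      []      = refl
  go (y ∷ l) (p ∷ h)
    rewrite cnt-∷ (suc k) y l | cnt-∷ k y l | go l h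
          | <ᵇ-cong {y} {k} {y} {suc k} (λ lt → <-trans lt (n<1+n k)) (λ lt → ≤∧≢⇒< (≤-pred lt) p) = refl
cnt-map-l {k} {y ∷ l} (y≢ ∷ u) (k≢y ∷ k≢) (there s∈)
  rewrite swapNum-o {k} (k≢y ∘ sym) (All.lookup y≢ s∈)
        | cnt-∷ (suc k) y (map (swapNum k) l) | cnt-∷ k y l | cnt-map-l u k≢ s∈
        | <ᵇ-cong {y} {k} {y} {suc k} (λ lt → <-trans lt (n<1+n k)) (λ lt → ≤∧≢⇒< (≤-pred lt) (k≢y ∘ sym))
  with y <ᵇ k
... | true  = refl
... | false = refl

All-map-swapNum : ∀ {k x l} → All (x ≢_) l → All (swapNum k x ≢_) (map (swapNum k) l)
All-map-swapNum {k} h = All.map⁺ (All.map (λ p → p ∘ swapNum-injective k) h)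

Unique-map-swapNum : ∀ k {l} → Unique l → Unique (map (swapNum k) l)
Unique-map-swapNum k = Unique.map⁺ (swapNum-injective k)

-- Relabelling is an involution that exchanges the two situations, so this is `cnt-map-l` applied to
-- the relabelled list.
cnt-map-r : ∀ {k l} → Unique l → All (suc k ≢_) l → k ∈ l →
            suc (cnt k (map (swapNum k) l)) ≡ cnt (suc k) l
cnt-map-r {k} {l} u s≢ k∈ =
  trans (sym (cnt-map-l (Unique-map-swapNum k u)
               (subst (λ z → All (z ≢_) (map (swapNum k) l)) (swapNum-r k) (All-map-swapNum {k} s≢))
               (subst (_∈ map (swapNum k) l) (swapNum-l k) (∈-map⁺ (swapNum k) k∈))))
        (cong (cnt (suc k)) (map-swapNum-involutive k l))

pos-here : ∀ x xs → pos (x ∷ xs) x ≡ 1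
pos-here x xs rewrite ≡ᵇ-true {x} refl = refl

pos-there : ∀ {x j} → x ≢ j → ∀ xs → pos (x ∷ xs) j ≡ suc (pos xs j)
pos-there x≢j xs rewrite ≡ᵇ-false x≢j = refl

pos-positive : ∀ {j xs} → j ∈ xs → 1 ≤ pos xs j
pos-positive {j} {x ∷ xs} _ with x ≡ᵇ j
... | true  = s≤s z≤n
... | false = s≤s z≤n

-- Bundles three readings of an ascent or descent: the effect of `up`, the change of length and the
-- order of occurrence. Knowing one of them decides the other two.
data Side (k : ℕ) (w : List ℕ) : Set where
  ascent  : up k w ≡ map (swapNum k) w → ℓ (map (swapNum k) w) ≡ suc (ℓ w) →
            pos w k < pos w (suc k) → Side k w
  descent : up k w ≡ w → suc (ℓ (map (swapNum k) w)) ≡ ℓ w →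
            pos w (suc k) < pos w k → Side k w

side : ∀ {k w} → Unique w → k ∈ w → suc k ∈ w → Side k w
side {k} {x ∷ w} (x≢ ∷ u) k∈ s∈ with view k x
side {k} {x ∷ w} (x≢ ∷ u) k∈ (here e) | isL = contradiction e 1+n≢n
side {k} {x ∷ w} (x≢ ∷ u) k∈ (there s∈) | isL = ascent
  (trans (up-l k w) (cong (_∷ map (swapNum k) w) (sym (swapNum-l k))))
  (subst (λ z → cnt z (map (swapNum k) w) + ℓ (map (swapNum k) w) ≡ suc (cnt k w + ℓ w)) (sym (swapNum-l k))
    (cong₂ _+_ (cnt-map-l u x≢ s∈) (ℓ-map-Lacks {k} {w} (inj₁ (All-≢-sym x≢)))))
  (subst₂ _<_ (sym (pos-here k w)) (sym (pos-there (1+n≢n ∘ sym) w)) (s≤s (pos-positive s∈)))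
side {k} {x ∷ w} (x≢ ∷ u) (here e) s∈ | isR = contradiction (sym e) 1+n≢n
side {k} {x ∷ w} (x≢ ∷ u) (there k∈) s∈ | isR = descent
  (up-r k w)
  (subst (λ z → suc (cnt z (map (swapNum k) w) + ℓ (map (swapNum k) w)) ≡ cnt (suc k) w + ℓ w) (sym (swapNum-r k))
    (cong₂ _+_ (cnt-map-r u x≢ k∈) (ℓ-map-Lacks {k} {w} (inj₂ (All-≢-sym x≢)))))
  (subst₂ _<_ (sym (pos-here (suc k) w)) (sym (pos-there 1+n≢n w)) (s≤s (pos-positive k∈)))
side {k} {x ∷ w} (x≢ ∷ u) (here e) s∈ | isO p q = contradiction (sym e) p
side {k} {x ∷ w} (x≢ ∷ u) (there k∈) (here e) | isO p q = contradiction (sym e) q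
side {k} {x ∷ w} (x≢ ∷ u) (there k∈) (there s∈) | isO p q with side u k∈ s∈
... | ascent a b c = ascent
  (trans (up-o p q w) (cong₂ _∷_ (sym (swapNum-o p q)) a))
  (trans (cong₂ _+_ (trans (cong (λ z → cnt z (map (swapNum k) w)) (swapNum-o p q)) (cnt-map-o {k} {x} {w} p q)) b)
         (+-suc (cnt x w) (ℓ w)))
  (subst₂ _<_ (sym (pos-there p w)) (sym (pos-there q w)) (s≤s c))
... | descent a b c = descent
  (trans (up-o p q w) (cong (x ∷_) a))
  (trans (sym (+-suc _ _))
    (cong₂ _+_ (trans (cong (λ z → cnt z (map (swapNum k) w)) (swapNum-o p q)) (cnt-map-o {k} {x} {w} p q)) b))
  (subst₂ _<_ (sym (pos-there q w)) (sym (pos-there p w)) (s≤s c))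

length-swapAt : ∀ i l → length (swapAt i l) ≡ length l
length-swapAt zero          l           = refl
length-swapAt (suc i)       []          = refl
length-swapAt (suc zero)    (a ∷ [])    = refl
length-swapAt (suc zero)    (a ∷ b ∷ l) = refl
length-swapAt (suc (suc i)) (a ∷ l)     = cong suc (length-swapAt (suc i) l)

swapAt-↭ : ∀ i l → swapAt i l ↭ l
swapAt-↭ zero          l           = ↭-refl
swapAt-↭ (suc i)       []          = ↭-refl
swapAt-↭ (suc zero)    (a ∷ [])    = ↭-refl
swapAt-↭ (suc zero)    (a ∷ b ∷ l) = swap b a ↭-refl
swapAt-↭ (suc (suc i)) (a ∷ l)     = prep a (swapAt-↭ (suc i) l)

swapNum-suc : ∀ k x → swapNum (suc k) (suc x) ≡ suc (swapNum k x)
swapNum-suc k x with x ≡ᵇ k | x ≡ᵇ suc k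
... | true  | _     = refl
... | false | true  = refl
... | false | false = refl

at-swapAt : ∀ i {w} → suc i < length w → ∀ j → at (swapAt (suc i) w) (swapNum (suc i) j) ≡ at w j
at-swapAt zero {_ ∷ []} (s≤s ())
at-swapAt zero {a ∷ b ∷ w} _ zero = refl
at-swapAt zero {a ∷ b ∷ w} _ (suc zero) = refl
at-swapAt zero {a ∷ b ∷ w} _ (suc (suc zero)) = refl
at-swapAt zero {a ∷ b ∷ w} _ (suc (suc (suc j))) = refl
at-swapAt (suc i) {a ∷ w} _ zero = refl
at-swapAt (suc i) {a ∷ w} _ (suc zero) = refl
at-swapAt (suc i) {a ∷ w} (s≤s lt) (suc (suc j))
  -- `at` passes the head only once two successors are visible; the first equation then folds one of
  -- them back for the induction hypothesis.
  rewrite swapNum-suc (suc i) (suc j) | swapNum-suc i j =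
  trans (cong (at (swapAt (suc i) w)) (sym (swapNum-suc i j))) (at-swapAt i {w} lt (suc j))

pos-swapAt : ∀ i {w x} → suc i < length w → Unique w → x ∈ w →
             pos (swapAt (suc i) w) x ≡ swapNum (suc i) (pos w x)
pos-swapAt zero {_ ∷ []} (s≤s ())
pos-swapAt zero {a ∷ b ∷ w} {x} _ ((a≢b ∷ _) ∷ _) x∈ with a ≟ x | b ≟ x
... | yes refl | yes refl = contradiction refl a≢b
... | yes refl | no b≢x rewrite pos-there b≢x (a ∷ w) | pos-here a w | pos-here a (b ∷ w) = refl
... | no a≢x | yes refl rewrite pos-there a≢x (b ∷ w) | pos-here b w | pos-here b (a ∷ w) = refl
... | no a≢x | no b≢x rewrite pos-there a≢x (b ∷ w) | pos-there b≢x (a ∷ w) | pos-there a≢x w | pos-there b≢x w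
  -- Here `x` lies beyond both positions. Its position in `w` is at least 1, hence at least 3 in the
  -- whole list, and the transposition of 1 and 2 fixes it.
  with pos w x | pos-positive (strip x∈)
  where
  strip : x ∈ a ∷ b ∷ w → x ∈ w
  strip (here e) = contradiction (sym e) a≢x
  strip (there (here e)) = contradiction (sym e) b≢x
  strip (there (there e)) = e
...   | suc p | _ = refl
pos-swapAt (suc i) {a ∷ w} {x} (s≤s lt) (_ ∷ u) x∈ with a ≟ x | x∈
... | yes refl | _ rewrite pos-here a (swapAt (suc i) w) | pos-here a w = refl
... | no a≢x | here e = contradiction (sym e) a≢x
... | no a≢x | there x∈w rewrite pos-there a≢x (swapAt (suc i) w) | pos-there a≢x w =
  trans (cong suc (pos-swapAt i {w} lt u x∈w)) (sym (swapNum-suc (suc i) (pos w x)))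

at-∈ : ∀ {w j} → 1 ≤ j → j ≤ length w → at w j ∈ w
at-∈ {x ∷ w} {suc zero}    _ _        = here refl
at-∈ {x ∷ w} {suc (suc j)} _ (s≤s le) = there (at-∈ (s≤s z≤n) le)

at-map : ∀ f {w j} → 1 ≤ j → j ≤ length w → at (map f w) j ≡ f (at w j)
at-map f {x ∷ w} {suc zero}    _ _        = refl
at-map f {x ∷ w} {suc (suc j)} _ (s≤s le) = at-map f {w} (s≤s z≤n) le

pos-at : ∀ {w j} → Unique w → 1 ≤ j → j ≤ length w → pos w (at w j) ≡ j
pos-at {x ∷ w} {suc zero}    _        _ _        = pos-here x w
pos-at {x ∷ w} {suc (suc j)} (h ∷ u) _ (s≤s le) =
  trans (pos-there (All.lookup h (at-∈ (s≤s z≤n) le)) w) (cong suc (pos-at u (s≤s z≤n) le))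

list-ext : ∀ {xs ys} → length xs ≡ length ys → (∀ j → 1 ≤ j → j ≤ length xs → at xs j ≡ at ys j) → xs ≡ ys
list-ext {[]}     {[]}     _  _ = refl
list-ext {x ∷ xs} {y ∷ ys} eq h = cong₂ _∷_ (h 1 (s≤s z≤n) (s≤s z≤n))
  (list-ext (suc-injective eq) λ { (suc j) _ le → h (suc (suc j)) (s≤s z≤n) (s≤s le) })

-- The identity and permutations in one-line notation

from : ℕ → ℕ → List ℕ
from o zero    = []
from o (suc n) = suc o ∷ from (suc o) n

oneTo≡from : ∀ m → oneTo m ≡ from 0 m
oneTo≡from m = go 0 m id (λ _ → refl)
  where
  go : ∀ o n f → (∀ i → f i ≡ o + i) → map suc (applyUpTo f n) ≡ from o n
  go o zero    f h = refl
  go o (suc n) f h = cong₂ _∷_ (cong suc (trans (h 0) (+-identityʳ o)))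
    (go (suc o) n (f ∘ suc) λ i → trans (h (suc i)) (+-suc o i))

length-from : ∀ o n → length (from o n) ≡ n
length-from o zero    = refl
length-from o (suc n) = cong suc (length-from (suc o) n)

from-> : ∀ o n → All (o <_) (from o n)
from-> o zero    = []
from-> o (suc n) = n<1+n o ∷ All.map (<-trans (n<1+n o)) (from-> (suc o) n)

from-≤ : ∀ o n → All (_≤ o + n) (from o n)
from-≤ o zero    = []
from-≤ o (suc n) rewrite +-suc o n = s≤s (m≤m+n o n) ∷ from-≤ (suc o) n

from-increasing : ∀ o n → AllPairs _<_ (from o n)
from-increasing o zero    = []
from-increasing o (suc n) = from-> (suc o) n ∷ from-increasing (suc o) n

at-from : ∀ o n i → i < n → at (from o n) (suc i) ≡ suc (o + i)
at-from o (suc n) zero    _        = cong suc (sym (+-identityʳ o))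
at-from o (suc n) (suc i) (s≤s lt) = trans (at-from (suc o) n i lt) (cong suc (sym (+-suc o i)))

map-swapNum-> : ∀ {k l} → All (suc k <_) l → map (swapNum k) l ≡ l
map-swapNum-> h = map-swapNum-fix (All.map (λ lt e → <-asym (subst (_ <_) e lt) (n<1+n _)) h)
                                  (All.map (λ lt e → <-irrefl (sym e) lt) h)

map-swapNum-from : ∀ o i {n} → suc i < n →
                   map (swapNum (suc (o + i))) (from o n) ≡ swapAt (suc i) (from o n)
map-swapNum-from o zero {suc zero} (s≤s ())
map-swapNum-from o zero {suc (suc n)} _ rewrite +-identityʳ o | swapNum-l (suc o) | swapNum-r (suc o) =
  cong (λ z → suc (suc o) ∷ suc o ∷ z) (map-swapNum-> (from-> (suc (suc o)) n))
map-swapNum-from o (suc i) {suc n} (s≤s lt) rewrite +-suc o i =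
  cong₂ _∷_ (swapNum-o (λ e → 1+n≰n (subst (suc o ≤_) (sym (suc-injective e)) (s≤s (m≤m+n o i))))
                       (λ e → 1+n≰n (subst (suc o ≤_) (sym (suc-injective e)) (m≤n⇒m≤1+n (s≤s (m≤m+n o i))))))
    (map-swapNum-from (suc o) i lt)

map-swapNum-oneTo : ∀ i {m} → suc i < m → map (swapNum (suc i)) (oneTo m) ≡ swapAt (suc i) (oneTo m)
map-swapNum-oneTo i {m} lt rewrite oneTo≡from m = map-swapNum-from 0 i lt

length-oneTo : ∀ m → length (oneTo m) ≡ m
length-oneTo m = trans (cong length (oneTo≡from m)) (length-from 0 m)

at-oneTo : ∀ {m j} → 1 ≤ j → j ≤ m → at (oneTo m) j ≡ j
at-oneTo {m} {suc j} _ le rewrite oneTo≡from m = at-from 0 m j le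

Unique-resp-↭ : ∀ {xs ys : List ℕ} → xs ↭ ys → Unique xs → Unique ys
Unique-resp-↭ p = ↭ₛ.Unique-resp-↭ (setoid ℕ) (↭⇒↭ₛ p)

module _ {m w} (w↭ : IsPerm m w) where

  IsPerm-length : length w ≡ m
  IsPerm-length = trans (↭-length w↭) (length-oneTo m)

  IsPerm-Unique : Unique w
  IsPerm-Unique = Unique-resp-↭ (↭-sym w↭)
    (subst Unique (sym (oneTo≡from m)) (AllPairs.map <⇒≢ (from-increasing 0 m)))

  IsPerm-∈ : ∀ {j} → 1 ≤ j → j ≤ m → j ∈ w
  IsPerm-∈ {j} 1≤j j≤m = ∈-resp-↭ (↭-sym w↭)
    (subst (_∈ oneTo m) (at-oneTo 1≤j j≤m) (at-∈ 1≤j (subst (j ≤_) (sym (length-oneTo m)) j≤m)))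

  IsPerm-positive : ∀ {x} → x ∈ w → 1 ≤ x
  IsPerm-positive x∈ = All.lookup (from-> 0 m) (subst (_ ∈_) (oneTo≡from m) (∈-resp-↭ w↭ x∈))

  IsPerm-≤ : ∀ {x} → x ∈ w → x ≤ m
  IsPerm-≤ x∈ = All.lookup (from-≤ 0 m) (subst (_ ∈_) (oneTo≡from m) (∈-resp-↭ w↭ x∈))

-- Reduced words and Demazure actions

cnt-swap : ∀ x pre {a b suf} → cnt x (pre ++ b ∷ a ∷ suf) ≡ cnt x (pre ++ a ∷ b ∷ suf)
cnt-swap x (y ∷ pre) {a} {b} {suf}
  rewrite cnt-∷ x y (pre ++ b ∷ a ∷ suf) | cnt-∷ x y (pre ++ a ∷ b ∷ suf) | cnt-swap x pre {a} {b} {suf} = refl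
cnt-swap x [] {a} {b} {suf}
  rewrite cnt-∷ x b (a ∷ suf) | cnt-∷ x a (b ∷ suf) | cnt-∷ x b suf | cnt-∷ x a suf
  with b <ᵇ x | a <ᵇ x
... | true  | true  = refl
... | true  | false = refl
... | false | true  = refl
... | false | false = refl

-- Earlier entries see the same entries after them in another order, and the pair sees the same
-- suffix; only the inversion of `b` over `a` is new.
ℓ-swap : ∀ pre {a b suf} → a < b → ℓ (pre ++ b ∷ a ∷ suf) ≡ suc (ℓ (pre ++ a ∷ b ∷ suf))
ℓ-swap (y ∷ pre) {a} {b} {suf} lt rewrite cnt-swap y pre {a} {b} {suf} | ℓ-swap pre {a} {b} {suf} lt =
  +-suc (cnt y (pre ++ a ∷ b ∷ suf)) _
ℓ-swap [] {a} {b} {suf} lt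
  rewrite cnt-∷ b a suf | cnt-∷ a b suf | <ᵇ-true lt | <ᵇ-false (<-asym lt) =
  cong suc (trans (sym (+-assoc (cnt b suf) (cnt a suf) (ℓ suf)))
           (trans (cong (_+ ℓ suf) (+-comm (cnt b suf) (cnt a suf))) (+-assoc (cnt a suf) (cnt b suf) (ℓ suf))))

swapAt-++ : ∀ pre {a b suf} → swapAt (suc (length pre)) (pre ++ a ∷ b ∷ suf) ≡ pre ++ b ∷ a ∷ suf
swapAt-++ []        = refl
swapAt-++ (x ∷ pre) = cong (x ∷_) (swapAt-++ pre)

demR-++ : ∀ pre i l → demR (suc (length pre + i)) (pre ++ l) ≡ pre ++ demR (suc i) l
demR-++ []        i l = refl
demR-++ (x ∷ pre) i l = cong (x ∷_) (demR-++ pre i l)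

demR-++-ascent : ∀ pre {a b suf} → a < b →
                 demR (suc (length pre)) (pre ++ a ∷ b ∷ suf) ≡ pre ++ b ∷ a ∷ suf
demR-++-ascent []        lt rewrite <ᵇ-true lt = refl
demR-++-ascent (x ∷ pre) lt = cong (x ∷_) (demR-++-ascent pre lt)

demR-ascent : ∀ i {w} → suc i < length w → at w (suc i) < at w (suc (suc i)) →
              demR (suc i) w ≡ swapAt (suc i) w
demR-ascent zero    {_ ∷ []}    (s≤s ())
demR-ascent zero    {a ∷ b ∷ w} _        lt rewrite <ᵇ-true lt = refl
demR-ascent (suc i) {a ∷ w}     (s≤s le) lt = cong (a ∷_) (demR-ascent i {w} le lt)

demR-↭ : ∀ i l → demR i l ↭ l
demR-↭ zero          l           = ↭-refl
demR-↭ (suc i)       []          = ↭-refl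
demR-↭ (suc zero)    (a ∷ [])    = ↭-refl
demR-↭ (suc zero)    (a ∷ b ∷ l) with a <ᵇ b
... | true  = swap b a ↭-refl
... | false = ↭-refl
demR-↭ (suc (suc i)) (a ∷ l)     = prep a (demR-↭ (suc i) l)

-- Left, right and two-sided actions of words

ups demRs : List ℕ → List ℕ → List ℕ
ups   ks w = foldr up w ks
demRs ks w = foldr demR w ks

star : ℕ → List ℕ → List ℕ
star k z = up k (demR k z)

stars : List ℕ → List ℕ → List ℕ
stars ks z = foldr star z ks

Bounded : ℕ → ℕ → Set
Bounded m k = 1 ≤ k × k < m

ℓ-from : ∀ o n → ℓ (from o n) ≡ 0
ℓ-from o zero    = refl
ℓ-from o (suc n) = cong₂ _+_ (go (from (suc o) n) (All.map <-asym (from-> (suc o) n))) (ℓ-from (suc o) n)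
  where
  go : ∀ l → All (λ y → ¬ y < suc o) l → cnt (suc o) l ≡ 0
  go []      []      = refl
  go (y ∷ l) (p ∷ h) rewrite cnt-∷ (suc o) y l | <ᵇ-false p = go l h

-- Supplies the induction in `words`: a descent can be undone to lower the length, and a list
-- without descents is sorted.
ascentFree⊎descent : ∀ w → Linked _≤_ w ⊎
  Σ (List ℕ) λ pre → ∃ λ a → ∃ λ b → Σ (List ℕ) λ suf → w ≡ pre ++ b ∷ a ∷ suf × a < b
ascentFree⊎descent []       = inj₁ []
ascentFree⊎descent (x ∷ []) = inj₁ [-]
ascentFree⊎descent (x ∷ y ∷ w) with y <? x | ascentFree⊎descent (y ∷ w)
... | yes lt | _ = inj₂ ([] , y , x , w , refl , lt)
... | no ¬lt | inj₁ h = inj₁ (≮⇒≥ ¬lt ∷ h)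
... | no _   | inj₂ (pre , a , b , suf , eq , lt) = inj₂ (x ∷ pre , a , b , suf , cong (x ∷_) eq , lt)

position-bound : ∀ {m} pre {a b suf} → IsPerm m (pre ++ a ∷ b ∷ suf) → Bounded m (suc (length pre))
position-bound {m} pre {a} {b} {suf} w↭ = s≤s z≤n ,
  subst (suc (length pre) <_) (trans (sym (length-++ pre)) (IsPerm-length w↭))
    (subst (suc (length pre) <_) (sym (trans (+-suc (length pre) (suc (length suf))) (cong suc (+-suc (length pre) (length suf)))))
      (s≤s (s≤s (m≤m+n (length pre) (length suf)))))

swap-↭ : ∀ pre {a b : ℕ} {suf} → pre ++ a ∷ b ∷ suf ↭ pre ++ b ∷ a ∷ suf
swap-↭ pre = ++⁺ˡ pre (swap _ _ ↭-refl)

module _ {m : ℕ} where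

  swapNum-IsPerm : ∀ {k w} → Bounded m k → IsPerm m w → IsPerm m (map (swapNum k) w)
  swapNum-IsPerm {suc i} (_ , lt) w↭ = ↭-trans (↭-map⁺ (swapNum (suc i)) w↭)
    (↭-trans (↭-reflexive (map-swapNum-oneTo i lt)) (swapAt-↭ (suc i) (oneTo m)))

  s-· : ∀ k {w} → IsPerm m w → s m k · w ≡ map (swapNum k) w
  s-· k {w} w↭ = map-cong-local (All.tabulate λ {x} x∈ →
    trans (at-map (swapNum k) {oneTo m} (IsPerm-positive w↭ x∈)
            (subst (x ≤_) (sym (length-oneTo m)) (IsPerm-≤ w↭ x∈)))
          (cong (swapNum k) (at-oneTo (IsPerm-positive w↭ x∈) (IsPerm-≤ w↭ x∈))))

  IsPerm-side : ∀ {k w} → Bounded m k → IsPerm m w → Side k w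
  IsPerm-side (1≤k , k<m) w↭ =
    side (IsPerm-Unique w↭) (IsPerm-∈ w↭ 1≤k (<⇒≤ k<m)) (IsPerm-∈ w↭ (s≤s z≤n) k<m)

  up-IsPerm : ∀ {k w} → Bounded m k → IsPerm m w → IsPerm m (up k w)
  up-IsPerm b w↭ with IsPerm-side b w↭
  ... | ascent e _ _  = subst (IsPerm m) (sym e) (swapNum-IsPerm b w↭)
  ... | descent e _ _ = subst (IsPerm m) (sym e) w↭

  demR-IsPerm : ∀ k {w} → IsPerm m w → IsPerm m (demR k w)
  demR-IsPerm k {w} w↭ = ↭-trans (demR-↭ k w) w↭

  demL≡up : ∀ {k w} → Bounded m k → IsPerm m w → demL m k w ≡ up k w
  demL≡up {k} {w} b w↭ rewrite s-· k w↭ with IsPerm-side b w↭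
  ... | ascent e h _  rewrite <ᵇ-true (subst (ℓ w <_) (sym h) (n<1+n _)) = sym e
  ... | descent e h _ rewrite <ᵇ-false (<-asym (subst (ℓ (map (swapNum k) w) <_) h (n<1+n _))) = sym e

  prod-IsPerm : ∀ {ks} → All (Bounded m) ks → IsPerm m (prod m ks)
  prod-IsPerm []                = ↭-refl
  prod-IsPerm {k ∷ ks} (b ∷ bs) = subst (IsPerm m) (sym (s-· k (prod-IsPerm bs))) (swapNum-IsPerm b (prod-IsPerm bs))

  prod-∷ : ∀ k {ks} → All (Bounded m) ks → prod m (k ∷ ks) ≡ map (swapNum k) (prod m ks)
  prod-∷ k bs = s-· k (prod-IsPerm bs)

  ups-IsPerm : ∀ {ks w} → All (Bounded m) ks → IsPerm m w → IsPerm m (ups ks w)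
  ups-IsPerm []       w↭ = w↭
  ups-IsPerm (b ∷ bs) w↭ = up-IsPerm b (ups-IsPerm bs w↭)

  demRs-IsPerm : ∀ ks {w} → IsPerm m w → IsPerm m (demRs ks w)
  demRs-IsPerm []       w↭ = w↭
  demRs-IsPerm (k ∷ ks) w↭ = demR-IsPerm k (demRs-IsPerm ks w↭)

  star-IsPerm : ∀ {k w} → Bounded m k → IsPerm m w → IsPerm m (star k w)
  star-IsPerm {k} b w↭ = up-IsPerm b (demR-IsPerm k w↭)

  stars-IsPerm : ∀ {ks w} → All (Bounded m) ks → IsPerm m w → IsPerm m (stars ks w)
  stars-IsPerm []       w↭ = w↭
  stars-IsPerm (b ∷ bs) w↭ = star-IsPerm b (stars-IsPerm bs w↭)

  act≡ups : ∀ {ks w} → All (Bounded m) ks → IsPerm m w → act m ks w ≡ ups ks w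
  act≡ups []                w↭ = refl
  act≡ups {k ∷ ks} (b ∷ bs) w↭ rewrite act≡ups bs w↭ = demL≡up b (ups-IsPerm bs w↭)

  ups-demR-comm : ∀ {ks} i {w} → All (Bounded m) ks → IsPerm m w →
                  ups ks (demR i w) ≡ demR i (ups ks w)
  ups-demR-comm i []                    w↭ = refl
  ups-demR-comm {k ∷ ks} i (b ∷ bs) w↭ =
    trans (cong (up k) (ups-demR-comm i bs w↭)) (up-demR-comm k i (IsPerm-Unique (ups-IsPerm bs w↭)))

  ups-demRs-comm : ∀ {ks} ts {w} → All (Bounded m) ks → IsPerm m w →
                   ups ks (demRs ts w) ≡ demRs ts (ups ks w)
  ups-demRs-comm []       bs w↭ = refl
  ups-demRs-comm (t ∷ ts) bs w↭ =
    trans (ups-demR-comm t bs (demRs-IsPerm ts w↭)) (cong (demR t) (ups-demRs-comm ts bs w↭))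

  -- Commutation carries the outermost right letter past the remaining left ones, next to its own
  -- left letter.
  ups-demRs≡stars : ∀ {ks w} → All (Bounded m) ks → IsPerm m w → ups ks (demRs ks w) ≡ stars ks w
  ups-demRs≡stars []                w↭ = refl
  ups-demRs≡stars {k ∷ ks} (b ∷ bs) w↭ = cong (up k)
    (trans (ups-demR-comm k bs (demRs-IsPerm ks w↭)) (cong (demR k) (ups-demRs≡stars bs w↭)))

  -- Reduced words in inductive form: every prepended letter is a true ascent. Both the effect of
  -- `up` and the comparison of positions are stored, the latter being what passes to inverses and
  -- to canonical lists.
  data Ascending : List ℕ → List ℕ → Set where
    []   : Ascending [] (oneTo m)
    step : ∀ {k ks w} → Bounded m k → Ascending ks w → up k w ≡ map (swapNum k) w →
           pos w k < pos w (suc k) → Ascending (k ∷ ks) (map (swapNum k) w)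

  Ascending-IsPerm : ∀ {ks v} → Ascending ks v → IsPerm m v
  Ascending-IsPerm []             = ↭-refl
  Ascending-IsPerm (step b a _ _) = swapNum-IsPerm b (Ascending-IsPerm a)

  Ascending-ups : ∀ {ks v} → Ascending ks v → ups ks (oneTo m) ≡ v
  Ascending-ups []                 = refl
  Ascending-ups (step {k} b a e _) = trans (cong (up k) (Ascending-ups a)) e

  ℓ-prod : ∀ {ks} → All (Bounded m) ks → ℓ (prod m ks) ≤ length ks
  ℓ-prod [] = ≤-reflexive (trans (cong ℓ (oneTo≡from m)) (ℓ-from 0 m))
  ℓ-prod {k ∷ ks} (b ∷ bs) rewrite prod-∷ k bs with IsPerm-side b (prod-IsPerm bs)
  ... | ascent _ h _  = ≤-trans (≤-reflexive h) (s≤s (ℓ-prod bs))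
  ... | descent _ h _ = ≤-trans (<⇒≤ (≤-reflexive h)) (m≤n⇒m≤1+n (ℓ-prod bs))

  -- Were the first letter a descent, the product of the remaining letters would be longer than
  -- their word, against `ℓ-prod`.
  reduced⇒ascending : ∀ {ks v} → ReducedWord m v ks → Ascending ks v
  reduced⇒ascending ([] , refl , _) = []
  reduced⇒ascending {k ∷ ks} (b ∷ bs , refl , len) rewrite prod-∷ k bs with IsPerm-side b (prod-IsPerm bs)
  ... | ascent e h c = step b (reduced⇒ascending (bs , refl , suc-injective (trans len h))) e c
  ... | descent _ h _ = contradiction
    (≤-trans (s≤s (m≤n⇒m≤1+n (≤-reflexive len))) (≤-trans (s≤s (≤-reflexive h)) (s≤s (ℓ-prod bs))))
    (<-irrefl refl)

  reduced-ups : ∀ {ks v} → ReducedWord m v ks → ups ks (oneTo m) ≡ v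
  reduced-ups r = Ascending-ups (reduced⇒ascending r)

  reduced-[] : ReducedWord m (oneTo m) []
  reduced-[] = [] , refl , sym (trans (cong ℓ (oneTo≡from m)) (ℓ-from 0 m))

  -- Prepended letters relabel values, which commutes with moving positions. The last letter meets
  -- the identity, where exchanging values and exchanging positions agree.
  prod-∷ʳ : ∀ {ks j} → All (Bounded m) ks → Bounded m j → prod m (ks ++ [ j ]) ≡ swapAt j (prod m ks)
  prod-∷ʳ {[]} {suc i} [] (_ , lt) = trans (s-· (suc i) ↭-refl) (map-swapNum-oneTo i lt)
  prod-∷ʳ {k ∷ ks} {j} (b ∷ bs) c = begin
    prod m (k ∷ ks ++ [ j ])                ≡⟨ prod-∷ k (All.++⁺ bs (c ∷ [])) ⟩
    map (swapNum k) (prod m (ks ++ [ j ]))  ≡⟨ cong (map (swapNum k)) (prod-∷ʳ bs c) ⟩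
    map (swapNum k) (swapAt j (prod m ks))  ≡⟨ map-swapAt (swapNum k) j (prod m ks) ⟩
    swapAt j (map (swapNum k) (prod m ks))  ≡⟨ cong (swapAt j) (prod-∷ k bs) ⟨
    swapAt j (prod m (k ∷ ks))              ∎
    where open ≡-Reasoning

  reduced-∷ʳ : ∀ pre {a b suf ks} → a < b → ReducedWord m (pre ++ a ∷ b ∷ suf) ks →
               ReducedWord m (pre ++ b ∷ a ∷ suf) (ks ++ [ suc (length pre) ])
  reduced-∷ʳ pre {a} {b} {suf} {ks} lt (bs , eq , len) = All.++⁺ bs (c ∷ []) ,
    trans (prod-∷ʳ bs c) (trans (cong (swapAt (suc (length pre))) eq) (swapAt-++ pre)) ,
    (begin
      length (ks ++ [ suc (length pre) ])  ≡⟨ length-++ ks ⟩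
      length ks + 1                        ≡⟨ +-comm (length ks) 1 ⟩
      suc (length ks)                      ≡⟨ cong suc len ⟩
      suc (ℓ (pre ++ a ∷ b ∷ suf))         ≡⟨ ℓ-swap pre lt ⟨
      ℓ (pre ++ b ∷ a ∷ suf)               ∎)
    where
    open ≡-Reasoning
    c = position-bound pre (subst (IsPerm m) eq (prod-IsPerm bs))

  -- Both results come from sorting by adjacent descents. Each descent undone gives a letter that is
  -- appended to the reduced word and placed outermost among the right actions.
  words : ∀ n {w} → ℓ w ≡ n → IsPerm m w →
          (Σ (List ℕ) (ReducedWord m w)) × (Σ (List ℕ) λ ts → demRs ts (oneTo m) ≡ w)
  words n {w} eq w↭ with ascentFree⊎descent w
  ... | inj₁ sorted = ([] , subst (λ z → ReducedWord m z []) (sym w≡id) reduced-[]) , ([] , sym w≡id)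
    where
    w≡id : w ≡ oneTo m
    w≡id = ≋⇒≡ (↗↭↗⇒≋ ≤-totalOrder sorted
      (subst (Linked _≤_) (sym (oneTo≡from m)) (AllPairs⇒Linked (AllPairs.map <⇒≤ (from-increasing 0 m))))
      (↭⇒↭ₛ w↭))
  words zero eq w↭ | inj₂ (pre , a , b , suf , refl , lt) = contradiction (trans (sym (ℓ-swap pre lt)) eq) λ ()
  words (suc n) eq w↭ | inj₂ (pre , a , b , suf , refl , lt)
    with words n (suc-injective (trans (sym (ℓ-swap pre lt)) eq)) (↭-trans (swap-↭ pre) w↭)
  ... | (ks , red) , (ts , e) = (ks ++ [ suc (length pre) ] , reduced-∷ʳ pre lt red) ,
    (suc (length pre) ∷ ts , trans (cong (demR (suc (length pre))) e) (demR-++-ascent pre lt))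

  reducedWord : ∀ {w} → IsPerm m w → Σ (List ℕ) (ReducedWord m w)
  reducedWord w↭ = proj₁ (words _ refl w↭)

  -- Writing y as a product of right actions turns ups ks y into a function of
  -- ups ks (oneTo m) alone; this replaces Matsumoto's theorem.
  ups-unique : ∀ {ks ks′ v y} → ReducedWord m v ks → ReducedWord m v ks′ → IsPerm m y → ups ks y ≡ ups ks′ y
  ups-unique {ks} {ks′} {v} r r′ y↭ with proj₂ (words _ refl y↭)
  ... | ts , refl = begin
    ups ks (demRs ts (oneTo m))   ≡⟨ ups-demRs-comm ts (proj₁ r) ↭-refl ⟩
    demRs ts (ups ks (oneTo m))   ≡⟨ cong (demRs ts) (trans (reduced-ups r) (sym (reduced-ups r′))) ⟩
    demRs ts (ups ks′ (oneTo m))  ≡⟨ ups-demRs-comm ts (proj₁ r′) ↭-refl ⟨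
    ups ks′ (demRs ts (oneTo m))  ∎
    where open ≡-Reasoning

  -- Inverses as words of right actions

  at-inv : ∀ {w j} → IsPerm m w → 1 ≤ j → j ≤ m → at (inv w) j ≡ pos w j
  at-inv {w} {j} w↭ 1≤j j≤m rewrite IsPerm-length w↭ =
    trans (at-map (pos w) {oneTo m} 1≤j (subst (j ≤_) (sym (length-oneTo m)) j≤m)) (cong (pos w) (at-oneTo 1≤j j≤m))

  length-inv : ∀ {w} → IsPerm m w → length (inv w) ≡ m
  length-inv {w} w↭ = trans (length-map (pos w) (oneTo (length w))) (trans (length-oneTo (length w)) (IsPerm-length w↭))

  pos-inv : ∀ {w j} → IsPerm m w → IsPerm m (inv w) → 1 ≤ j → j ≤ m → pos (inv w) j ≡ at w j
  pos-inv {w} {j} w↭ i↭ 1≤j j≤m = begin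
    pos (inv w) j                        ≡⟨ cong (pos (inv w)) (pos-at (IsPerm-Unique w↭) 1≤j j≤len) ⟨
    pos (inv w) (pos w (at w j))         ≡⟨ cong (pos (inv w)) (at-inv w↭ (IsPerm-positive w↭ at∈) (IsPerm-≤ w↭ at∈)) ⟨
    pos (inv w) (at (inv w) (at w j))    ≡⟨ pos-at (IsPerm-Unique i↭) (IsPerm-positive w↭ at∈)
                                              (subst (at w j ≤_) (sym (length-inv w↭)) (IsPerm-≤ w↭ at∈)) ⟩
    at w j                               ∎
    where
    open ≡-Reasoning
    j≤len = subst (j ≤_) (sym (IsPerm-length w↭)) j≤m
    at∈ = at-∈ 1≤j j≤len

  -- That the inverse is a permutation is a hypothesis here because `inv-IsPerm` is itself derived
  -- from this lemma, by way of `inv≡demRs`.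
  inv-inv′ : ∀ {w} → IsPerm m w → IsPerm m (inv w) → inv (inv w) ≡ w
  inv-inv′ {w} w↭ i↭ = list-ext (trans (length-inv i↭) (sym (IsPerm-length w↭)))
    λ j 1≤j j≤len → let j≤m = subst (j ≤_) (length-inv i↭) j≤len in
      trans (at-inv i↭ 1≤j j≤m) (pos-inv w↭ i↭ 1≤j j≤m)

  inv-swapAt : ∀ {i w} → suc i < m → IsPerm m w → inv (swapAt (suc i) w) ≡ map (swapNum (suc i)) (inv w)
  inv-swapAt {i} {w} lt w↭ rewrite length-swapAt (suc i) w | IsPerm-length w↭ =
    trans (map-cong-local (All.tabulate λ {x} x∈ →
             pos-swapAt i {w} (subst (suc i <_) (sym (IsPerm-length w↭)) lt) (IsPerm-Unique w↭) (∈-resp-↭ (↭-sym w↭) x∈)))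
          (map-∘ (oneTo m))

  -- If `k` occurs before `suc k` in a permutation, the inverse increases from position `k` to the
  -- next one. Hence no right letter is idle, and each one relabels the inverse.
  inv-demRs : ∀ {ks v} → Ascending ks v → inv (demRs ks (oneTo m)) ≡ v
  inv-demRs [] = list-ext (trans (length-inv {oneTo m} ↭-refl) (sym (length-oneTo m))) λ j 1≤j j≤len →
    let j≤m = subst (j ≤_) (length-inv {oneTo m} ↭-refl) j≤len in
    trans (at-inv {oneTo m} ↭-refl 1≤j j≤m)
      (trans (cong (pos (oneTo m)) (sym (at-oneTo 1≤j j≤m)))
      (trans (pos-at (IsPerm-Unique {m} {oneTo m} ↭-refl) 1≤j (subst (j ≤_) (sym (length-oneTo m)) j≤m))
             (sym (at-oneTo 1≤j j≤m))))
  inv-demRs (step {suc i} {ks} {w} (_ , lt) a e c) = begin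
    inv (demR (suc i) u)           ≡⟨ cong inv (demR-ascent i {u} (subst (suc i <_) (sym (IsPerm-length u↭)) lt) asc) ⟩
    inv (swapAt (suc i) u)         ≡⟨ inv-swapAt lt u↭ ⟩
    map (swapNum (suc i)) (inv u)  ≡⟨ cong (map (swapNum (suc i))) (inv-demRs a) ⟩
    map (swapNum (suc i)) w        ∎
    where
    open ≡-Reasoning
    u = demRs ks (oneTo m)
    u↭ = demRs-IsPerm ks {oneTo m} ↭-refl
    i↭ = subst (IsPerm m) (sym (inv-demRs a)) (Ascending-IsPerm a)
    asc : at u (suc i) < at u (suc (suc i))
    asc = subst₂ _<_ (pos-inv u↭ i↭ (s≤s z≤n) (<⇒≤ lt)) (pos-inv u↭ i↭ (s≤s z≤n) lt)
      (subst (λ z → pos z (suc i) < pos z (suc (suc i))) (sym (inv-demRs a)) c)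

  inv≡demRs : ∀ {ks v} → Ascending ks v → inv v ≡ demRs ks (oneTo m)
  inv≡demRs {ks} a = trans (cong inv (sym (inv-demRs a)))
    (inv-inv′ (demRs-IsPerm ks {oneTo m} ↭-refl) (subst (IsPerm m) (sym (inv-demRs a)) (Ascending-IsPerm a)))

  inv-IsPerm : ∀ {v} → IsPerm m v → IsPerm m (inv v)
  inv-IsPerm v↭ with reducedWord v↭
  ... | ks , r = subst (IsPerm m) (sym (inv≡demRs (reduced⇒ascending r))) (demRs-IsPerm ks {oneTo m} ↭-refl)

  inv-inv : ∀ {v} → IsPerm m v → inv (inv v) ≡ v
  inv-inv v↭ = inv-inv′ v↭ (inv-IsPerm v↭)

  -- For `f` = w_fpf and v = w⁻¹ the left side is w⁻¹ ∘ w_fpf ∘ w. The right actions that build the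
  -- inverse move outside `ups kf`, which then turns the identity into `f`.
  ups-ups≡stars : ∀ {kf f ks v} → ReducedWord m f kf → ReducedWord m v ks → ups ks (ups kf (inv v)) ≡ stars ks f
  ups-ups≡stars {kf} {f} {ks} {v} rf r = begin
    ups ks (ups kf (inv v))                  ≡⟨ cong (ups ks ∘ ups kf) (inv≡demRs (reduced⇒ascending r)) ⟩
    ups ks (ups kf (demRs ks (oneTo m)))     ≡⟨ cong (ups ks) (ups-demRs-comm ks (proj₁ rf) ↭-refl) ⟩
    ups ks (demRs ks (ups kf (oneTo m)))     ≡⟨ cong (ups ks ∘ demRs ks) (reduced-ups rf) ⟩
    ups ks (demRs ks f)                      ≡⟨ ups-demRs≡stars (proj₁ r) (Ascending-IsPerm (reduced⇒ascending rf)) ⟩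
    stars ks f                               ∎
    where open ≡-Reasoning

  -- The two-sided value is rewritten as a left action on `ups kf (inv v)`, which mentions `v` but
  -- neither word, so that `ups-unique` applies.
  stars-unique : ∀ {f ks ks′ v} → IsPerm m f → ReducedWord m v ks → ReducedWord m v ks′ → stars ks f ≡ stars ks′ f
  stars-unique f↭ r r′ with reducedWord f↭
  ... | kf , rf = trans (sym (ups-ups≡stars rf r))
    (trans (ups-unique r r′ (ups-IsPerm (proj₁ rf) (inv-IsPerm (Ascending-IsPerm (reduced⇒ascending r)))))
           (ups-ups≡stars rf r′))

odds-bounded : ∀ n → All (Bounded (2 * n)) (map (λ i → suc (2 * i)) (upTo n))
odds-bounded n = All.map⁺ (All.applyUpTo⁺₁ id n λ {i} i<n →
  s≤s z≤n , ≤-trans (≤-reflexive (sym (*-suc 2 i))) (*-monoʳ-≤ 2 i<n))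

wfpf-IsPerm : ∀ n → IsPerm (2 * n) (wfpf n)
wfpf-IsPerm n = prod-IsPerm (odds-bounded n)

-- v⁻¹ ∈ B_FPF(x), as x = s_{k₁} ∘ ⋯ ∘ s_{kᵣ} ∘ w_fpf ∘ s_{kᵣ} ∘ ⋯ ∘ s_{k₁}
-- for a reduced word of v.
Atom : ℕ → List ℕ → List ℕ → Set
Atom n x v = Σ (List ℕ) λ ks → ReducedWord (2 * n) v ks × stars ks (wfpf n) ≡ x

BFPF⇒Atom : ∀ {n x w} → BFPF n x w → Atom n x (inv w)
BFPF⇒Atom {n} {x} {w} (w↭ , y , (kf , rf , refl) , (ks , r , refl)) = ks , r , (begin
  stars ks (wfpf n)                     ≡⟨ ups-ups≡stars rf r ⟨
  ups ks (ups kf (inv (inv w)))         ≡⟨ cong (ups ks ∘ ups kf) (inv-inv w↭) ⟩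
  ups ks (ups kf w)                     ≡⟨ act≡ups (proj₁ r) (ups-IsPerm (proj₁ rf) w↭) ⟨
  act (2 * n) ks (ups kf w)             ≡⟨ cong (act (2 * n) ks) (act≡ups (proj₁ rf) w↭) ⟨
  act (2 * n) ks (act (2 * n) kf w)     ∎)
  where open ≡-Reasoning

Atom⇒BFPF : ∀ {n x v} → IsPerm (2 * n) v → Atom n x v → BFPF n x (inv v)
Atom⇒BFPF {n} {x} {v} v↭ (ks , r , refl) with reducedWord (wfpf-IsPerm n)
... | kf , rf = inv-IsPerm v↭ , act (2 * n) kf (inv v) , (kf , rf , refl) ,
  (ks , subst (λ z → ReducedWord (2 * n) z ks) (sym (inv-inv v↭)) r , (begin
    act (2 * n) ks (act (2 * n) kf (inv v))  ≡⟨ cong (act (2 * n) ks) (act≡ups (proj₁ rf) (inv-IsPerm v↭)) ⟩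
    act (2 * n) ks (ups kf (inv v))          ≡⟨ act≡ups (proj₁ r) (ups-IsPerm (proj₁ rf) (inv-IsPerm v↭)) ⟩
    ups ks (ups kf (inv v))                  ≡⟨ ups-ups≡stars rf r ⟩
    stars ks (wfpf n)                        ∎))
  where open ≡-Reasoning

-- Local moves at w_fpf

-- One-line notation of w_fpf with all values raised by `o`; the offset lets it be cut after any
-- number of blocks.
paired : ℕ → ℕ → List ℕ
paired o zero    = []
paired o (suc n) = suc (suc o) ∷ suc o ∷ paired (suc (suc o)) n

paired-> : ∀ o n → All (o <_) (paired o n)
paired-> o zero    = []
paired-> o (suc n) = m<n⇒m<1+n (n<1+n o) ∷ n<1+n o ∷
  All.map (≤-trans (m≤n⇒m≤1+n (m≤n⇒m≤1+n ≤-refl))) (paired-> (suc (suc o)) n)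

paired-≤ : ∀ o n → All (_≤ 2 * n + o) (paired o n)
paired-≤ o zero    = []
paired-≤ o (suc n) = subst (λ z → All (_≤ z + o) (paired o (suc n))) (sym (*-suc 2 n))
  (s≤s (s≤s (m≤n+m o (2 * n))) ∷ s≤s (m≤n⇒m≤1+n (m≤n+m o (2 * n))) ∷
   subst (λ z → All (_≤ z) (paired (suc (suc o)) n))
     (trans (+-suc (2 * n) (suc o)) (cong suc (+-suc (2 * n) o))) (paired-≤ (suc (suc o)) n))

length-paired : ∀ o n → length (paired o n) ≡ 2 * n
length-paired o zero    = refl
length-paired o (suc n) = trans (cong (suc ∘ suc) (length-paired (suc (suc o)) n)) (sym (*-suc 2 n))

paired-+ : ∀ o k j → paired o (k + j) ≡ paired o k ++ paired (2 * k + o) j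
paired-+ o zero    j = refl
paired-+ o (suc k) j = cong (λ z → suc (suc o) ∷ suc o ∷ z) (trans (paired-+ (suc (suc o)) k j)
  (cong (λ z → paired (suc (suc o)) k ++ paired z j)
    (trans (+-suc (2 * k) (suc o)) (trans (cong suc (+-suc (2 * k) o)) (cong (_+ o) (sym (*-suc 2 k)))))))

odds : ℕ → ℕ → List ℕ
odds o zero    = []
odds o (suc n) = suc o ∷ odds (suc (suc o)) n

swaps : List ℕ → List ℕ → List ℕ
swaps ks l = foldr (λ k → map (swapNum k)) l ks

map-upTo≡odds : ∀ n → map (λ i → suc (2 * i)) (upTo n) ≡ odds 0 n
map-upTo≡odds n = go 0 n id (λ _ → refl)
  where
  -- Passing to the tail replaces `f` by `f ∘ suc` and raises the offset by two, so the invariant is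
  -- stated for the doubled index.
  go : ∀ o n f → (∀ i → 2 * f i ≡ o + 2 * i) → map (λ i → suc (2 * i)) (applyUpTo f n) ≡ odds o n
  go o zero    f h = refl
  go o (suc n) f h = cong₂ _∷_ (cong suc (trans (h 0) (+-identityʳ o)))
    (go (suc (suc o)) n (f ∘ suc) λ i → trans (h (suc i)) (trans (cong (o +_) (*-suc 2 i))
      (trans (+-suc o (suc (2 * i))) (cong suc (+-suc o (2 * i))))))

swaps-odds-∷ : ∀ {o x} n l → x ≤ o → swaps (odds o n) (x ∷ l) ≡ x ∷ swaps (odds o n) l
swaps-odds-∷ zero    l le = refl
swaps-odds-∷ {o} {x} (suc n) l le =
  trans (cong (map (swapNum (suc o))) (swaps-odds-∷ n l (m≤n⇒m≤1+n (m≤n⇒m≤1+n le))))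
        (cong (_∷ _) (swapNum-o (<⇒≢ (s≤s le)) (<⇒≢ (m<n⇒m<1+n (s≤s le)))))

swaps-odds : ∀ o n → swaps (odds o n) (from o (2 * n)) ≡ paired o n
swaps-odds o zero    = refl
swaps-odds o (suc n) = begin
  map (swapNum (suc o)) (swaps O (from o (2 * suc n)))
    ≡⟨ cong (λ z → map (swapNum (suc o)) (swaps O (from o z))) (*-suc 2 n) ⟩
  map (swapNum (suc o)) (swaps O (suc o ∷ suc (suc o) ∷ F))
    ≡⟨ cong (map (swapNum (suc o))) (swaps-odds-∷ n (suc (suc o) ∷ F) (n≤1+n (suc o))) ⟩
  map (swapNum (suc o)) (suc o ∷ swaps O (suc (suc o) ∷ F))
    ≡⟨ cong (λ z → map (swapNum (suc o)) (suc o ∷ z)) (swaps-odds-∷ n F ≤-refl) ⟩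
  map (swapNum (suc o)) (suc o ∷ suc (suc o) ∷ swaps O F)
    ≡⟨ cong (λ z → map (swapNum (suc o)) (suc o ∷ suc (suc o) ∷ z)) (swaps-odds (suc (suc o)) n) ⟩
  map (swapNum (suc o)) (suc o ∷ suc (suc o) ∷ paired (suc (suc o)) n)
    ≡⟨ cong₂ _∷_ (swapNum-l (suc o)) (cong₂ _∷_ (swapNum-r (suc o)) (map-swapNum-> (paired-> (suc (suc o)) n))) ⟩
  suc (suc o) ∷ suc o ∷ paired (suc (suc o)) n ∎
  where
  open ≡-Reasoning
  O = odds (suc (suc o)) n
  F = from (suc (suc o)) (2 * n)

prod≡swaps : ∀ {m ks} → All (Bounded m) ks → prod m ks ≡ swaps ks (oneTo m)
prod≡swaps []                = refl
prod≡swaps {m} {k ∷ ks} (b ∷ bs) = trans (prod-∷ k bs) (cong (map (swapNum k)) (prod≡swaps bs))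

wfpf≡paired : ∀ n → wfpf n ≡ paired 0 n
wfpf≡paired n = trans (prod≡swaps (odds-bounded n))
  (trans (cong₂ swaps (map-upTo≡odds n) (oneTo≡from (2 * n))) (swaps-odds 0 n))

-- Locality of the actions

up-++-fix : ∀ {k} l {S} → All (suc k <_) S → up k (l ++ S) ≡ up k l ++ S
up-++-fix {k} [] {[]} h = refl
up-++-fix {k} [] {x ∷ S} (lt ∷ h) =
  trans (up-o (λ e → <-asym (subst (suc k <_) e lt) (n<1+n k)) (λ e → <-irrefl (sym e) lt) S)
        (cong (x ∷_) (up-++-fix [] h))
up-++-fix {k} (x ∷ l) {S} h with x ≡ᵇ k | x ≡ᵇ suc k
... | true  | _     = cong (suc k ∷_) (trans (map-++ (swapNum k) l S) (cong (map (swapNum k) l ++_) (map-swapNum-> h)))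
... | false | true  = refl
... | false | false = cong (x ∷_) (up-++-fix l h)

up-fix-++ : ∀ {k P} l → All (_< k) P → up k (P ++ l) ≡ P ++ up k l
up-fix-++ l []                 = refl
up-fix-++ {k} {x ∷ P} l (lt ∷ h) = trans (up-o (<⇒≢ lt) (<⇒≢ (m<n⇒m<1+n lt)) (P ++ l)) (cong (x ∷_) (up-fix-++ l h))

+-≡ᵇ : ∀ o x y → (o + x ≡ᵇ o + y) ≡ (x ≡ᵇ y)
+-≡ᵇ zero    x y = refl
+-≡ᵇ (suc o) x y = +-≡ᵇ o x y

+-<ᵇ : ∀ o x y → (o + x <ᵇ o + y) ≡ (x <ᵇ y)
+-<ᵇ zero    x y = refl
+-<ᵇ (suc o) x y = +-<ᵇ o x y

swapNum-+ : ∀ o k x → swapNum (o + k) (o + x) ≡ o + swapNum k x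
swapNum-+ zero    k x = refl
swapNum-+ (suc o) k x = trans (swapNum-suc (o + k) (o + x)) (cong suc (swapNum-+ o k x))

up-+ : ∀ o k l → up (o + k) (map (o +_) l) ≡ map (o +_) (up k l)
up-+ o k []      = refl
up-+ o k (x ∷ l)
  rewrite +-≡ᵇ o x k | trans (cong (o + x ≡ᵇ_) (sym (+-suc o k))) (+-≡ᵇ o x (suc k)) with x ≡ᵇ k | x ≡ᵇ suc k
... | true  | _     = cong₂ _∷_ (sym (+-suc o k)) (trans (sym (map-∘ l)) (trans (map-cong (swapNum-+ o k) l) (map-∘ l)))
... | false | true  = refl
... | false | false = cong (o + x ∷_) (up-+ o k l)

demR-+ : ∀ o i l → demR i (map (o +_) l) ≡ map (o +_) (demR i l)
demR-+ o zero          l           = refl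
demR-+ o (suc i)       []          = refl
demR-+ o (suc zero)    (a ∷ [])    = refl
demR-+ o (suc zero)    (a ∷ b ∷ l) rewrite +-<ᵇ o a b with a <ᵇ b
... | true  = refl
... | false = refl
demR-+ o (suc (suc i)) (a ∷ l)     = cong (o + a ∷_) (demR-+ o (suc i) l)

demR-++ˡ : ∀ i l {S} → suc i < length l → demR (suc i) (l ++ S) ≡ demR (suc i) l ++ S
demR-++ˡ zero    (a ∷ [])    (s≤s ())
demR-++ˡ zero    (a ∷ b ∷ l) _ with a <ᵇ b
... | true  = refl
... | false = refl
demR-++ˡ (suc i) (a ∷ l)     (s≤s lt) = cong (a ∷_) (demR-++ˡ i l lt)

-- The two positions lie inside the block, and so do the two values, since `P` holds smaller values
-- and `S` larger ones. A step at any place thus becomes a computation on a small closed list.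
star-local : ∀ {P S o} L i → length P ≡ o → All (_≤ o) P → suc i < length L → All (o + length L <_) S →
             star (o + suc i) (P ++ map (o +_) L ++ S) ≡ P ++ map (o +_) (star (suc i) L) ++ S
star-local {P} {S} {o} L i refl P≤ lt S> = begin
  up k (demR (o + suc i) (P ++ M ++ S))         ≡⟨ cong (λ z → up k (demR z (P ++ M ++ S))) (+-suc o i) ⟩
  up k (demR (suc (o + i)) (P ++ M ++ S))       ≡⟨ cong (up k) (demR-++ P i (M ++ S)) ⟩
  up k (P ++ demR (suc i) (M ++ S))             ≡⟨ cong (λ z → up k (P ++ z)) (demR-++ˡ i M i<M) ⟩
  up k (P ++ demR (suc i) M ++ S)               ≡⟨ cong (λ z → up k (P ++ z ++ S)) (demR-+ o (suc i) L) ⟩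
  up k (P ++ map (o +_) (demR (suc i) L) ++ S)  ≡⟨ up-fix-++ _ P<k ⟩
  P ++ up k (map (o +_) (demR (suc i) L) ++ S)  ≡⟨ cong (P ++_) (up-++-fix (map (o +_) (demR (suc i) L)) S>k) ⟩
  P ++ up k (map (o +_) (demR (suc i) L)) ++ S  ≡⟨ cong (λ z → P ++ z ++ S) (up-+ o (suc i) (demR (suc i) L)) ⟩
  P ++ map (o +_) (star (suc i) L) ++ S         ∎
  where
  open ≡-Reasoning
  k = o + suc i
  M = map (o +_) L
  i<M = subst (suc i <_) (sym (length-map (o +_) L)) lt
  P<k = All.map (λ le → ≤-trans (s≤s (≤-trans le (m≤m+n o i))) (≤-reflexive (sym (+-suc o i)))) P≤
  S>k = All.map (≤-<-trans (subst (_≤ o + length L) (+-suc o (suc i)) (+-monoʳ-≤ o lt))) S>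

stars-∷ʳ : ∀ ks k f → stars (ks ++ [ k ]) f ≡ stars ks (star k f)
stars-∷ʳ ks k f = foldr-++ star f ks [ k ]

-- The new letter is written as an offset plus a position inside the block, the shape that
-- `star-local` expects.
reduced-local : ∀ {m} pre L {a b suf ks} → a < b → ReducedWord m (pre ++ L ++ a ∷ b ∷ suf) ks →
                ReducedWord m (pre ++ L ++ b ∷ a ∷ suf) (ks ++ [ length pre + suc (length L) ])
reduced-local {m} pre L {a} {b} {suf} {ks} lt r = subst₂ (ReducedWord m) (++-assoc pre L (b ∷ a ∷ suf))
  (cong (λ z → ks ++ [ z ]) (trans (cong suc (length-++ pre)) (sym (+-suc (length pre) (length L)))))
  (reduced-∷ʳ (pre ++ L) lt (subst (λ z → ReducedWord m z ks) (sym (++-assoc pre L (a ∷ b ∷ suf))) r))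

Unique-++⁻ʳ : ∀ (xs : List ℕ) {ys} → Unique (xs ++ ys) → Unique ys
Unique-++⁻ʳ []       u       = u
Unique-++⁻ʳ (x ∷ xs) (_ ∷ u) = Unique-++⁻ʳ xs u

-- Natural-number twin of `Pattern`, as `ℕStep` is of `Step`: a chain starting at a permutation
-- never leaves the image of `seq`.
data Quad (a b c d : ℕ) : List ℕ → Set where
  p1 : Quad a b c d (a ∷ d ∷ b ∷ c ∷ [])
  p2 : Quad a b c d (b ∷ c ∷ a ∷ d ∷ [])
  p3 : Quad a b c d (b ∷ d ∷ a ∷ c ∷ [])
  p4 : Quad a b c d (c ∷ d ∷ a ∷ b ∷ [])

data ℕStep : List ℕ → List ℕ → Set where
  swap : ∀ (pre suf : List ℕ) (k : ℕ) → length pre ≡ 2 * k → ∀ a b →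
         ℕStep (pre ++ a ∷ b ∷ suf) (pre ++ b ∷ a ∷ suf)
  quad : ∀ (pre suf : List ℕ) (k : ℕ) → length pre ≡ 2 * k →
         ∀ a b c d → a ≤ b → b ≤ c → c ≤ d →
         ∀ p q → Quad a b c d p → Quad a b c d q →
         ℕStep (pre ++ p ++ suf) (pre ++ q ++ suf)

Quad-↭ : ∀ {a b c d p} → Quad a b c d p → p ↭ a ∷ b ∷ c ∷ d ∷ []
Quad-↭ {a} {b} {c} {d} p1 = prep a (↭-trans (swap d b ↭-refl) (prep b (swap d c ↭-refl)))
Quad-↭ {a} {b} {c} {d} p2 = ↭-trans (prep b (swap c a ↭-refl)) (swap b a ↭-refl)
Quad-↭ {a} {b} {c} {d} p3 = ↭-trans (prep b (swap d a ↭-refl)) (swap b a (swap d c ↭-refl))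
Quad-↭ {a} {b} {c} {d} p4 = ++-comm (c ∷ d ∷ []) (a ∷ b ∷ [])

ℕStep-↭ : ∀ {v v′} → ℕStep v v′ → v ↭ v′
ℕStep-↭ (swap pre suf k _ a b) = swap-↭ pre
ℕStep-↭ (quad pre suf k _ a b c d _ _ _ p q P Q) =
  ++⁺ˡ pre (++⁺ʳ suf (↭-trans (Quad-↭ P) (↭-sym (Quad-↭ Q))))

module _ {n : ℕ} where

  -- Counts the pairs to the right of the block, so that `paired` can be cut on both sides of it.
  blocks-≤ : ∀ pre L {suf k j} → length pre ≡ 2 * k → length L ≡ 2 * j → IsPerm (2 * n) (pre ++ L ++ suf) →
             ∃ λ i → n ≡ k + (j + i)
  blocks-≤ pre L {suf} {k} {j} eq eq′ w↭ = n ∸ (k + j) ,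
    sym (trans (sym (+-assoc k j (n ∸ (k + j)))) (m+[n∸m]≡n {k + j} (*-cancelˡ-≤ 2 (subst₂ _≤_
      (trans (cong₂ _+_ eq eq′) (sym (*-distribˡ-+ 2 k j)))
      (trans (cong (length pre +_) (sym (length-++ L))) (trans (sym (length-++ pre)) (IsPerm-length w↭)))
      (+-monoʳ-≤ (length pre) (m≤m+n (length L) (length suf)))))))

  Atom-unique : ∀ {x y v} → Atom n x v → Atom n y v → x ≡ y
  Atom-unique (ks , r , refl) (ks′ , r′ , refl) = stars-unique (wfpf-IsPerm n) r r′

  -- The appended letter is the first to act on w_fpf. It meets a block 2 1, already descending in
  -- positions and in values, and is idle.
  Atom-swap : ∀ pre {a b suf k} → length pre ≡ 2 * k → a < b → IsPerm (2 * n) (pre ++ a ∷ b ∷ suf) →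
              ∃ λ x → Atom n x (pre ++ a ∷ b ∷ suf) × Atom n x (pre ++ b ∷ a ∷ suf)
  Atom-swap pre {a} {b} {suf} {k} len lt w↭
    with reducedWord w↭ | blocks-≤ pre (a ∷ b ∷ []) {suf} {k} {1} len refl w↭
  ... | ks , r | i , n≡ = stars ks (wfpf n) , (ks , r , refl) ,
    (ks ++ [ length pre + 1 ] , reduced-local pre [] lt r ,
     trans (stars-∷ʳ ks (length pre + 1) (wfpf n)) (cong (stars ks) fix))
    where
    P = paired 0 k
    o = 2 * k
    S = paired (suc (suc o)) i
    S> : All (o + 2 <_) S
    S> = subst (λ z → All (z <_) S) (+-comm 2 o) (paired-> (suc (suc o)) i)
    split : wfpf n ≡ P ++ map (o +_) (2 ∷ 1 ∷ []) ++ S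
    split = trans (wfpf≡paired n) (trans (cong (paired 0) n≡) (trans (paired-+ 0 k (suc i))
      (cong (P ++_) (trans (cong (λ z → paired z (suc i)) (+-identityʳ o))
        (cong₂ (λ x y → x ∷ y ∷ S) (+-comm 2 o) (+-comm 1 o))))))
    P≤ : All (_≤ o) P
    P≤ = subst (λ z → All (_≤ z) P) (+-identityʳ o) (paired-≤ 0 k)
    fix : star (length pre + 1) (wfpf n) ≡ wfpf n
    fix = trans (cong₂ (λ x y → star (x + 1) y) len split)
      (trans (star-local (2 ∷ 1 ∷ []) 0 (length-paired 0 k) P≤ ≤-refl S>) (sym split))

  -- From the increasing arrangement the four patterns are reached by appending 3 2, 1 2, 1 3 2 and
  -- 2 1 3 2, up to the offset. The last letter acts first and takes 2143 to 3412; the letter 1 or 3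
  -- gives 4321, the longest element of S₄, which absorbs every further letter. All four values are
  -- therefore that of `ks` at 4321.
  Atom-quad : ∀ pre {a b c d suf k} → length pre ≡ 2 * k → a < b → b < c → c < d →
              IsPerm (2 * n) (pre ++ a ∷ b ∷ c ∷ d ∷ suf) →
              ∃ λ x → ∀ {p} → Quad a b c d p → Atom n x (pre ++ p ++ suf)
  Atom-quad pre {a} {b} {c} {d} {suf} {k} len a<b b<c c<d w↭
    with reducedWord w↭ | blocks-≤ pre (a ∷ b ∷ c ∷ d ∷ []) {suf} {k} {2} len refl w↭
  ... | ks , r | i , n≡ = stars ks (state (4 ∷ 3 ∷ 2 ∷ 1 ∷ [])) , λ
    { p1 → _ , reduced-local pre (a ∷ []) b<d (reduced-local pre (a ∷ b ∷ []) c<d r) ,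
           trans (stars-∷ʳ (ks ++ [ length pre + 3 ]) (length pre + 2) (wfpf n))
           (trans (stars-∷ʳ ks (length pre + 3) (star (length pre + 2) (wfpf n)))
             (cong (stars ks) (trans (cong (star (length pre + 3)) start) (local 2 l3412 2<4))))
    ; p2 → _ , reduced-local pre (b ∷ []) a<c (reduced-local pre [] a<b r) ,
           trans (stars-∷ʳ (ks ++ [ length pre + 1 ]) (length pre + 2) (wfpf n))
           (trans (stars-∷ʳ ks (length pre + 1) (star (length pre + 2) (wfpf n)))
             (cong (stars ks) (trans (cong (star (length pre + 1)) start) (local 0 l3412 0<4))))
    ; p3 → _ , reduced-local pre (b ∷ []) a<d (reduced-local pre (b ∷ a ∷ []) c<d (reduced-local pre [] a<b r)) ,
           trans (stars-∷ʳ ((ks ++ [ length pre + 1 ]) ++ [ length pre + 3 ]) (length pre + 2) (wfpf n))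
           (trans (stars-∷ʳ (ks ++ [ length pre + 1 ]) (length pre + 3) (star (length pre + 2) (wfpf n)))
           (trans (stars-∷ʳ ks (length pre + 1) (star (length pre + 3) (star (length pre + 2) (wfpf n))))
             (cong (stars ks) (trans (cong (star (length pre + 1)) (trans (cong (star (length pre + 3)) start) (local 2 l3412 2<4)))
               (local 0 l4321 0<4)))))
    -- The letters act in the order 2, 3, 1, 2, and the last two are idle at 4321.
    ; p4 → _ , reduced-local pre (c ∷ []) a<d
                 (reduced-local pre (c ∷ a ∷ []) b<d (reduced-local pre [] a<c (reduced-local pre (a ∷ []) b<c r))) ,
           trans (stars-∷ʳ (((ks ++ [ length pre + 2 ]) ++ [ length pre + 1 ]) ++ [ length pre + 3 ]) (length pre + 2) (wfpf n))
           (trans (stars-∷ʳ ((ks ++ [ length pre + 2 ]) ++ [ length pre + 1 ]) (length pre + 3) (star (length pre + 2) (wfpf n)))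
           (trans (stars-∷ʳ (ks ++ [ length pre + 2 ]) (length pre + 1) (star (length pre + 3) (star (length pre + 2) (wfpf n))))
           (trans (stars-∷ʳ ks (length pre + 2) (star (length pre + 1) (star (length pre + 3) (star (length pre + 2) (wfpf n)))))
             (cong (stars ks) (trans (cong (λ z → star (length pre + 2) (star (length pre + 1) z))
                (trans (cong (star (length pre + 3)) start) (local 2 l3412 2<4)))
               (trans (cong (star (length pre + 2)) (local 0 l4321 0<4)) (local 1 l4321 1<4))))))) }
    where
    a<c = <-trans a<b b<c
    b<d = <-trans b<c c<d
    a<d = <-trans a<c c<d
    0<4 : 1 < 4
    0<4 = s≤s (s≤s z≤n)
    1<4 : 2 < 4
    1<4 = s≤s (s≤s (s≤s z≤n))
    2<4 : 3 < 4
    2<4 = s≤s (s≤s (s≤s (s≤s z≤n)))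
    l3412 l4321 : Σ (List ℕ) λ L → length L ≡ 4
    l3412 = 3 ∷ 4 ∷ 1 ∷ 2 ∷ [] , refl
    l4321 = 4 ∷ 3 ∷ 2 ∷ 1 ∷ [] , refl
    P = paired 0 k
    o = 2 * k
    S = paired (suc (suc (suc (suc o)))) i
    state : List ℕ → List ℕ
    state L = P ++ map (o +_) L ++ S
    split : wfpf n ≡ state (2 ∷ 1 ∷ 4 ∷ 3 ∷ [])
    split = trans (wfpf≡paired n) (trans (cong (paired 0) n≡) (trans (paired-+ 0 k (suc (suc i)))
      (cong (P ++_) (trans (cong (λ z → paired z (suc (suc i))) (+-identityʳ o))
        (trans (cong₂ (λ x y → x ∷ y ∷ suc (suc (suc (suc o))) ∷ suc (suc (suc o)) ∷ S) (+-comm 2 o) (+-comm 1 o))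
          (cong₂ (λ x y → o + 2 ∷ o + 1 ∷ x ∷ y ∷ S) (+-comm 4 o) (+-comm 3 o)))))))
    P≤ : All (_≤ o) P
    P≤ = subst (λ z → All (_≤ z) P) (+-identityʳ o) (paired-≤ 0 k)
    S> : All (o + 4 <_) S
    S> = subst (λ z → All (z <_) S) (+-comm 4 o) (paired-> (suc (suc (suc (suc o)))) i)
    local : ∀ j (L : Σ (List ℕ) λ L → length L ≡ 4) → suc j < 4 →
            star (length pre + suc j) (state (proj₁ L)) ≡ state (star (suc j) (proj₁ L))
    local j (L , eq) lt = trans (cong (λ z → star (z + suc j) (state L)) len)
      (star-local L j (length-paired 0 k) P≤ (subst (suc j <_) (sym eq) lt) (subst (λ z → All (o + z <_) S) (sym eq) S>))
    start : star (length pre + 2) (wfpf n) ≡ state (3 ∷ 4 ∷ 1 ∷ 2 ∷ [])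
    start = trans (cong (star (length pre + 2)) split) (local 1 (2 ∷ 1 ∷ 4 ∷ 3 ∷ [] , refl) 1<4)

Atom-ℕStep : ∀ {n x v v′} → ℕStep v v′ → IsPerm (2 * n) v → Atom n x v → Atom n x v′
Atom-ℕStep {n} (swap pre suf k len a b) v↭ at with Unique-++⁻ʳ pre (IsPerm-Unique v↭) | <-cmp a b
... | (a≢b ∷ _) ∷ _ | tri≈ _ e _ = contradiction e a≢b
... | _ | tri< lt _ _ with Atom-swap {n} pre {k = k} len lt v↭
...   | _ , at₁ , at₂ = subst (λ z → Atom n z _) (Atom-unique {n} at₁ at) at₂
Atom-ℕStep {n} (swap pre suf k len a b) v↭ at | _ | tri> _ _ lt
  with Atom-swap {n} pre {k = k} len lt (↭-trans (swap-↭ pre) v↭)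
...   | _ , at₁ , at₂ = subst (λ z → Atom n z _) (Atom-unique {n} at₂ at) at₁
Atom-ℕStep {n} (quad pre suf k len a b c d a≤b b≤c c≤d p q P Q) v↭ at
  -- The increasing arrangement is the common source of both patterns; its distinct entries make the
  -- weak inequalities strict.
  with ↭-trans (++⁺ˡ pre (++⁺ʳ suf (↭-sym (Quad-↭ P)))) v↭
... | w↭ with Unique-++⁻ʳ pre (IsPerm-Unique w↭)
... | (a≢b ∷ _) ∷ (b≢c ∷ _) ∷ (c≢d ∷ _) ∷ _
  with Atom-quad {n} pre {k = k} len (≤∧≢⇒< a≤b a≢b) (≤∧≢⇒< b≤c b≢c) (≤∧≢⇒< c≤d c≢d) w↭
... | _ , atoms = subst (λ z → Atom n z (pre ++ q ++ suf)) (Atom-unique {n} (atoms P) at) (atoms Q)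

-- From integer sequences back to permutations

seq-++⁻ : ∀ v {xs ys} → xs ++ ys ≡ seq v →
          Σ (List ℕ) λ xs′ → Σ (List ℕ) λ ys′ → v ≡ xs′ ++ ys′ × xs ≡ seq xs′ × ys ≡ seq ys′
seq-++⁻ v       {[]}     eq = [] , v , refl , refl , eq
seq-++⁻ (y ∷ v) {x ∷ xs} eq with ∷-injective eq
... | refl , eq′ with seq-++⁻ v {xs} eq′
...   | xs′ , ys′ , refl , e , e′ = y ∷ xs′ , ys′ , refl , cong (ℤ.+ y ∷_) e , e′

Pattern⇒Quad : ∀ {a b c d p p′} → Pattern a b c d p → p ≡ seq p′ →
  ∃ λ a′ → ∃ λ b′ → ∃ λ c′ → ∃ λ d′ →
    (a ≡ ℤ.+ a′ × b ≡ ℤ.+ b′ × c ≡ ℤ.+ c′ × d ≡ ℤ.+ d′) × Quad a′ b′ c′ d′ p′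
Pattern⇒Quad {p′ = x ∷ y ∷ z ∷ w ∷ []} p1 refl = _ , _ , _ , _ , (refl , refl , refl , refl) , p1
Pattern⇒Quad {p′ = x ∷ y ∷ z ∷ w ∷ []} p2 refl = _ , _ , _ , _ , (refl , refl , refl , refl) , p2
Pattern⇒Quad {p′ = x ∷ y ∷ z ∷ w ∷ []} p3 refl = _ , _ , _ , _ , (refl , refl , refl , refl) , p3
Pattern⇒Quad {p′ = x ∷ y ∷ z ∷ w ∷ []} p4 refl = _ , _ , _ , _ , (refl , refl , refl , refl) , p4

Pattern-seq : ∀ {a b c d q} → Pattern (ℤ.+ a) (ℤ.+ b) (ℤ.+ c) (ℤ.+ d) q →
              Σ (List ℕ) λ q′ → Quad a b c d q′ × q ≡ seq q′
Pattern-seq p1 = _ , p1 , refl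
Pattern-seq p2 = _ , p2 , refl
Pattern-seq p3 = _ , p3 , refl
Pattern-seq p4 = _ , p4 , refl

Quad-seq : ∀ {a b c d q} → Quad a b c d q → Pattern (ℤ.+ a) (ℤ.+ b) (ℤ.+ c) (ℤ.+ d) (seq q)
Quad-seq p1 = p1
Quad-seq p2 = p2
Quad-seq p3 = p3
Quad-seq p4 = p4

Step⇒ℕStep : ∀ {x y v} → Step x y → x ≡ seq v → Σ (List ℕ) λ v′ → y ≡ seq v′ × ℕStep v v′
Step⇒ℕStep {v = v} (swap pre suf k len a b) eq with seq-++⁻ v {pre} eq
... | pre′ , a′ ∷ b′ ∷ suf′ , refl , refl , refl = _ , sym (map-++ ℤ.+_ pre′ _) ,
  swap pre′ suf′ k (trans (sym (length-map ℤ.+_ pre′)) len) a′ b′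
Step⇒ℕStep {v = v} (quad pre suf k len a b c d a≤b b≤c c≤d p q P Q) eq with seq-++⁻ v {pre} eq
... | pre′ , ys′ , refl , refl , eq′ with seq-++⁻ ys′ {p} eq′
... | p′ , suf′ , refl , e , refl with Pattern⇒Quad P e
... | a′ , b′ , c′ , d′ , (refl , refl , refl , refl) , P′ with Pattern-seq Q
... | q′ , Q′ , refl = pre′ ++ q′ ++ suf′ ,
  sym (trans (map-++ ℤ.+_ pre′ _) (cong (seq pre′ ++_) (map-++ ℤ.+_ q′ suf′))) ,
  quad pre′ suf′ k (trans (sym (length-map ℤ.+_ pre′)) len) a′ b′ c′ d′
    (ℤ.drop‿+≤+ a≤b) (ℤ.drop‿+≤+ b≤c) (ℤ.drop‿+≤+ c≤d) p′ q′ P′ Q′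

Step-sym : ∀ {x y} → Step x y → Step y x
Step-sym (swap pre suf k len a b) = swap pre suf k len b a
Step-sym (quad pre suf k len a b c d a≤b b≤c c≤d p q P Q) = quad pre suf k len a b c d a≤b b≤c c≤d q p Q P

Atom-∼B : ∀ {n x u w} → seq u ∼B seq w → IsPerm (2 * n) u → Atom n x u → Atom n x w
Atom-∼B {n} {x} {u} {w} u∼w u↭ at = go u∼w refl u↭ at
  where
  -- Intermediate members of the chain are known only as integer lists, so the permutation behind
  -- each is carried along by an equation.
  go : ∀ {z u} → z ∼B seq w → z ≡ seq u → IsPerm (2 * n) u → Atom n x u → Atom n x w
  go ε eq u↭ at = subst (Atom n x) (sym (map-injective ℤ.+-injective eq)) at
  go (st ◅ rest) eq u↭ at with Step⇒ℕStep (direct st) eq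
    where
    direct : ∀ {x y} → SymClosure Step x y → Step x y
    direct (fwd st) = st
    direct (bwd st) = Step-sym st
  ... | v′ , eq′ , st′ = go rest eq′ (↭-trans (↭-sym (ℕStep-↭ st′)) u↭) (Atom-ℕStep {n} st′ u↭ at)

-- Canonical representatives

-- a₁ b₁ a₂ b₂ … with aᵢ < bᵢ and a₁ < a₂ < ⋯: the minimal representatives.
data Canon : List ℕ → Set where
  []  : Canon []
  _∷_ : ∀ {a b l} → a < b × All (a <_) l → Canon l → Canon (a ∷ b ∷ l)

∼B-∷∷ : ∀ {a b l l′} → seq l ∼B seq l′ → seq (a ∷ b ∷ l) ∼B seq (a ∷ b ∷ l′)
∼B-∷∷ {a} {b} = gmap (λ z → ℤ.+ a ∷ ℤ.+ b ∷ z) λ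
  { (swap pre suf k len x y) → swap (ℤ.+ a ∷ ℤ.+ b ∷ pre) suf (suc k) (len′ k len) x y
  ; (quad pre suf k len x y z w h₁ h₂ h₃ p q P Q) →
      quad (ℤ.+ a ∷ ℤ.+ b ∷ pre) suf (suc k) (len′ k len) x y z w h₁ h₂ h₃ p q P Q }
  where
  len′ : ∀ {j} k → j ≡ 2 * k → suc (suc j) ≡ 2 * suc k
  len′ k e = trans (cong (suc ∘ suc) e) (sym (*-suc 2 k))

Canonical : List ℕ → Set
Canonical v = Σ (List ℕ) λ c → Canon c × c ↭ v × seq v ∼B seq c

-- Every pattern is turned into `p1`, where the least entry leads and is paired with the greatest;
-- the middle two entries are left to be placed among the rest.
Canonical-quad : ∀ {a b c d l p} → a < b → b < c → c < d → All (a <_) l → Quad a b c d p →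
                 Canonical (b ∷ c ∷ l) → Canonical (p ++ l)
Canonical-quad {a} {b} {c} {d} {l} {p} a<b b<c c<d a< P (e , e-canon , e↭ , ∼e) =
  a ∷ d ∷ e , (a<d , All-resp-↭ (↭-sym e↭) (a<b ∷ <-trans a<b b<c ∷ a<)) ∷ e-canon ,
  ↭-trans (prep a (prep d e↭)) (++⁺ʳ l (↭-trans (Quad-↭ {a} {b} {c} {d} p1) (↭-sym (Quad-↭ P)))) ,
  return (subst (λ z → Step z (seq (a ∷ d ∷ b ∷ c ∷ l))) (sym (map-++ ℤ.+_ p l))
    (quad [] (seq l) 0 refl (ℤ.+ a) (ℤ.+ b) (ℤ.+ c) (ℤ.+ d)
      (ℤ.+≤+ (<⇒≤ a<b)) (ℤ.+≤+ (<⇒≤ b<c)) (ℤ.+≤+ (<⇒≤ c<d)) _ _ (Quad-seq P) p1))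
  ◅◅ ∼B-∷∷ ∼e
  where
  a<d = <-trans a<b (<-trans b<c c<d)

-- If `a` is not below the first canonical pair, the relative order of `a`, `b` and `b₁` selects the
-- pattern `p4`, `p3` or `p2`. The entry `a₁` keeps the lead and the middle two of the four entries
-- are inserted further on.
insert : ∀ {a b l} → a < b → Unique (a ∷ b ∷ l) → Canon l → Canonical (a ∷ b ∷ l)
insert a<b u [] = _ , (a<b , []) ∷ [] , ↭-refl , ε
insert {a} {b} {a₁ ∷ b₁ ∷ l} a<b ((_ ∷ a≢a₁ ∷ a≢b₁ ∷ a≢) ∷ (b≢a₁ ∷ b≢b₁ ∷ b≢) ∷ _ ∷ b₁≢ ∷ u) ((a₁<b₁ , a₁<) ∷ cl)
  with <-cmp a a₁ | <-cmp a b₁ | <-cmp b b₁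
... | tri< a<a₁ _ _ | _ | _ =
  _ , (a<b , a<a₁ ∷ <-trans a<a₁ a₁<b₁ ∷ All.map (<-trans a<a₁) a₁<) ∷ (a₁<b₁ , a₁<) ∷ cl , ↭-refl , ε
... | tri≈ _ e _ | _ | _ = contradiction e a≢a₁
... | _ | tri≈ _ e _ | _ = contradiction e a≢b₁
... | _ | _ | tri≈ _ e _ = contradiction e b≢b₁
... | tri> _ _ a₁<a | tri> _ _ b₁<a | _ = Canonical-quad a₁<b₁ b₁<a a<b a₁< p4
  (insert b₁<a ((a≢b₁ ∘ sym ∷ b₁≢) ∷ a≢ ∷ u) cl)
... | tri> _ _ a₁<a | tri< a<b₁ _ _ | tri> _ _ b₁<b = Canonical-quad a₁<a a<b₁ b₁<b a₁< p3
  (insert a<b₁ ((a≢b₁ ∷ a≢) ∷ b₁≢ ∷ u) cl)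
... | tri> _ _ a₁<a | tri< a<b₁ _ _ | tri< b<b₁ _ _ = Canonical-quad a₁<a a<b b<b₁ a₁< p2
  (insert a<b ((<⇒≢ a<b ∷ a≢) ∷ b≢ ∷ u) cl)

canonical : ∀ n {v} → length v ≡ 2 * n → Unique v → Canonical v
canonical zero {[]} _ _ = [] , [] , ↭-refl , ε
canonical (suc n) {[]} eq _ = contradiction eq λ ()
canonical (suc n) {_ ∷ []} eq _ = contradiction (trans eq (*-suc 2 n)) λ ()
canonical (suc n) {a ∷ b ∷ l} eq u@((a≢b ∷ _) ∷ _ ∷ ul)
  with canonical n (suc-injective (suc-injective (trans eq (*-suc 2 n)))) ul
... | c , c-canon , c↭ , ∼c with <-cmp a b
...   | tri≈ _ e _ = contradiction e a≢b
...   | tri< a<b _ _ with insert a<b (Unique-resp-↭ (prep a (prep b (↭-sym c↭))) u) c-canon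
...     | e , e-canon , e↭ , ∼e = e , e-canon , ↭-trans e↭ (prep a (prep b c↭)) , ∼B-∷∷ ∼c ◅◅ ∼e
canonical (suc n) {a ∷ b ∷ l} eq u | c , c-canon , c↭ , ∼c | tri> _ _ b<a
  with insert b<a (Unique-resp-↭ (swap a b (↭-sym c↭)) u) c-canon
...     | e , e-canon , e↭ , ∼e = e , e-canon , ↭-trans e↭ (swap b a c↭) ,
  return (swap [] (seq l) 0 refl (ℤ.+ a) (ℤ.+ b)) ◅◅ ∼B-∷∷ ∼c ◅◅ ∼e

-- Involutions read as matchings

data Matches (z : List ℕ) : List ℕ → Set where
  []  : Matches z []
  _∷_ : ∀ {a b l} → at z a ≡ b × at z b ≡ a → Matches z l → Matches z (a ∷ b ∷ l)

Matches-∈ : ∀ {z l x} → Matches z l → x ∈ l → at z x ∈ l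
Matches-∈ ((e , _) ∷ M) (here refl)         = there (here e)
Matches-∈ ((_ , e) ∷ M) (there (here refl)) = here e
Matches-∈ (_ ∷ M)       (there (there x∈))  = there (there (Matches-∈ M x∈))

Matches-involutive : ∀ {z l x} → Matches z l → x ∈ l → at z (at z x) ≡ x
Matches-involutive {z} ((e , e′) ∷ M) (here refl)         = trans (cong (at z) e) e′
Matches-involutive {z} ((e , e′) ∷ M) (there (here refl)) = trans (cong (at z) e′) e
Matches-involutive (_ ∷ M)            (there (there x∈))  = Matches-involutive M x∈

Matches-fixedPointFree : ∀ {z l x} → Canon l → Matches z l → x ∈ l → at z x ≢ x
Matches-fixedPointFree ((lt , _) ∷ _) ((e , _) ∷ _) (here refl)         e′ = <⇒≢ lt (trans (sym e′) e)
Matches-fixedPointFree ((lt , _) ∷ _) ((_ , e) ∷ _) (there (here refl)) e′ = <⇒≢ lt (trans (sym e) e′)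
Matches-fixedPointFree (_ ∷ C)        (_ ∷ M)       (there (there x∈))     = Matches-fixedPointFree C M x∈

Matches-agree : ∀ {x z l y} → Matches x l → Matches z l → y ∈ l → at x y ≡ at z y
Matches-agree ((e , _) ∷ _) ((e′ , _) ∷ _) (here refl)         = trans e (sym e′)
Matches-agree ((_ , e) ∷ _) ((_ , e′) ∷ _) (there (here refl)) = trans e (sym e′)
Matches-agree (_ ∷ M)       (_ ∷ M′)       (there (there y∈))  = Matches-agree M M′ y∈

at-conj : ∀ i {z x} → suc i < length z → 1 ≤ swapNum (suc i) x → swapNum (suc i) x ≤ length z →
          at (map (swapNum (suc i)) (swapAt (suc i) z)) (swapNum (suc i) x) ≡ swapNum (suc i) (at z x)
at-conj i {z} {x} lt 1≤ ≤len =
  trans (at-map (swapNum (suc i)) {swapAt (suc i) z} 1≤ (subst (swapNum (suc i) x ≤_) (sym (length-swapAt (suc i) z)) ≤len))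
        (cong (swapNum (suc i)) (at-swapAt i {z} lt x))

-- Conjugating by a transposition relabels the matched pairs. The bounds keep the indices inside the
-- list, where `at` commutes with `map`.
Matches-conj : ∀ i {z l} → suc i < length z →
               All (λ x → 1 ≤ swapNum (suc i) x × swapNum (suc i) x ≤ length z) l → Matches z l →
               Matches (map (swapNum (suc i)) (swapAt (suc i) z)) (map (swapNum (suc i)) l)
Matches-conj i lt [] [] = []
Matches-conj i {z} lt ((p , q) ∷ (p′ , q′) ∷ h) ((e , e′) ∷ M) =
  (trans (at-conj i {z} lt p q) (cong (swapNum (suc i)) e) , trans (at-conj i {z} lt p′ q′) (cong (swapNum (suc i)) e′))
  ∷ Matches-conj i {z} lt h M

swapNum-mono⁻ : ∀ k {a b} → swapNum k a < swapNum k b → (a ≡ suc k → b ≢ k) → a < b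
swapNum-mono⁻ k {a} {b} lt h = subst₂ _<_ (swapNum-involutive k a) (swapNum-involutive k b)
  (swapNum-mono k lt λ e e′ → h (swapNum-≡l e) (swapNum-≡r e′))

Canon-Lacks⁻ : ∀ {k l} → All (_≢ k) l → Canon (map (swapNum k) l) → Canon l
Canon-Lacks⁻ [] [] = []
Canon-Lacks⁻ {k} (p ∷ q ∷ h) ((lt , lts) ∷ C) =
  (swapNum-mono⁻ k lt (λ _ → q) ,
   All.zipWith (λ { (lt′ , r) → swapNum-mono⁻ k lt′ (λ _ → r) }) (All.map⁻ lts , h)) ∷ Canon-Lacks⁻ h C

∈-tail : ∀ {x y : ℕ} {l} → x ∈ y ∷ l → y ≢ x → x ∈ l
∈-tail (here e)   ne = contradiction (sym e) ne
∈-tail (there x∈) _  = x∈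

-- If `k` opened a pair of `w`, its relabelling `suc k` would precede the smaller `k` in a canonical
-- list. So `k` closes a pair, and its opener lies below all later entries, among them the partner
-- of `suc k`. This last inequality is what makes the right action a true swap.
Canon-ascent : ∀ {k w} → Unique w → k ∈ w → suc k ∈ w → pos w k < pos w (suc k) →
               Canon (map (swapNum k) w) → Canon w × (∀ {z} → Matches z w → at z k < at z (suc k))
Canon-ascent {k} {a ∷ b ∷ l} (a≢ ∷ b≢ ∷ u) k∈ s∈ lt ((a<b , a<) ∷ C) with view k a
... | isL = contradiction
  (All.lookup (a<b ∷ a<) (subst (_∈ map (swapNum k) (b ∷ l)) (swapNum-r k) (∈-map⁺ (swapNum k) (∈-tail s∈ (1+n≢n ∘ sym)))))
  (subst (λ z → ¬ z < k) (sym (swapNum-l k)) (<-asym (n<1+n k)))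
... | isR = contradiction
  (≤-trans (s≤s (pos-positive k∈)) (subst (pos (suc k ∷ b ∷ l) k <_) (pos-here (suc k) (b ∷ l)) lt)) (<-irrefl refl)
... | isO p q with view k b
...   | isL = (swapNum-mono⁻ k a<b (λ e → contradiction e q) , a<l) ∷ Canon-Lacks⁻ (All-≢-sym b≢) C ,
  λ { {z} ((e , e′) ∷ M) → subst (_< at z (suc k)) (sym e′)
        (All.lookup a<l (Matches-∈ M (∈-tail (∈-tail s∈ q) (1+n≢n ∘ sym)))) }
  where
  a<l = All.map (λ lt′ → swapNum-mono⁻ k lt′ (λ e → contradiction e q)) (All.map⁻ a<)
...   | isR = contradiction
  (subst₂ _<_ (trans (pos-there p (suc k ∷ l)) (cong suc (pos-there (1+n≢n {k}) l)))
              (trans (pos-there q (suc k ∷ l)) (cong suc (pos-here (suc k) l))) lt) λ { (s≤s (s≤s ())) }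
...   | isO p′ q′ with Canon-ascent u (∈-tail (∈-tail k∈ p) p′) (∈-tail (∈-tail s∈ q) q′)
        (≤-pred (≤-pred (subst₂ _<_ (trans (pos-there p (b ∷ l)) (cong suc (pos-there p′ l)))
                                    (trans (pos-there q (b ∷ l)) (cong suc (pos-there q′ l))) lt))) C
...     | C′ , f = (swapNum-mono⁻ k a<b (λ e → contradiction e q) ,
                    All.map (λ lt′ → swapNum-mono⁻ k lt′ (λ e → contradiction e q)) (All.map⁻ a<)) ∷ C′ ,
                   λ { (_ ∷ M) → f M }

at-++ : ∀ (Q : List ℕ) {l j} → at (Q ++ l) (length Q + suc j) ≡ at l (suc j)
at-++ []      = refl
at-++ (x ∷ Q) {l} {j} rewrite +-suc (length Q) j = trans (cong (at (Q ++ l)) (sym (+-suc (length Q) j))) (at-++ Q)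

-- `Q` collects the blocks already passed, because `z` stays the whole list while the induction
-- consumes its tail.
Matches-from-paired : ∀ n {z} Q → z ≡ Q ++ paired (length Q) n → Matches z (from (length Q) (2 * n))
Matches-from-paired zero    Q eq = []
Matches-from-paired (suc n) {z} Q refl = subst (Matches z) (cong (from o) (sym (*-suc 2 n)))
  ((trans (cong (at z) (+-comm 1 o)) (at-++ Q) , trans (cong (at z) (+-comm 2 o)) (at-++ Q)) ∷
   subst (λ t → Matches z (from t (2 * n))) len
     (Matches-from-paired n (Q ++ suc (suc o) ∷ suc o ∷ [])
       (trans (sym (++-assoc Q (suc (suc o) ∷ suc o ∷ []) _))
              (cong (λ t → (Q ++ suc (suc o) ∷ suc o ∷ []) ++ paired t n) (sym len)))))
  where
  o = length Q
  len : length (Q ++ suc (suc o) ∷ suc o ∷ []) ≡ suc (suc o)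
  len = trans (length-++ Q) (+-comm o 2)

Canon-Matches : ∀ {n ks v} → All (Bounded (2 * n)) ks → Ascending {2 * n} ks v → Canon v → Matches (stars ks (wfpf n)) v
Canon-Matches {n} _ [] _ = subst₂ Matches (sym (wfpf≡paired n)) (sym (oneTo≡from (2 * n)))
  (Matches-from-paired n [] refl)
Canon-Matches {n} (_ ∷ bs) (step {suc i} {ks} {w} b@(_ , k<m) A e lt) C
  with Canon-ascent (IsPerm-Unique (Ascending-IsPerm A)) (IsPerm-∈ (Ascending-IsPerm A) (s≤s z≤n) (<⇒≤ k<m))
         (IsPerm-∈ (Ascending-IsPerm A) (s≤s z≤n) k<m) lt C
... | C′ , f = subst (λ t → Matches t (map (swapNum k) w)) (sym star≡)
  (Matches-conj i {z} k<len
    (All.tabulate λ x∈ → IsPerm-positive v↭ (∈-map⁺ (swapNum k) x∈) ,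
      subst (_ ≤_) (sym (IsPerm-length z↭)) (IsPerm-≤ v↭ (∈-map⁺ (swapNum k) x∈))) M)
  where
  open ≡-Reasoning
  k = suc i
  z = stars ks (wfpf n)
  w↭ = Ascending-IsPerm A
  v↭ = swapNum-IsPerm b w↭
  z↭ = stars-IsPerm bs (wfpf-IsPerm n)
  k<len = subst (k <_) (sym (IsPerm-length z↭)) k<m
  M = Canon-Matches {n} bs A C′
  -- As `z` is an involution on these entries, the position of `x` in it is its image; moving
  -- positions relabels that number.
  pos≡at : ∀ {x} → 1 ≤ x → x ≤ 2 * n → pos (swapAt k z) x ≡ swapNum k (at z x)
  pos≡at {x} 1≤x x≤m = trans (pos-swapAt i {z} k<len (IsPerm-Unique z↭) (IsPerm-∈ z↭ 1≤x x≤m)) (cong (swapNum k) (begin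
    pos z x                ≡⟨ cong (pos z) (Matches-involutive M x∈) ⟨
    pos z (at z (at z x))  ≡⟨ pos-at (IsPerm-Unique z↭) (IsPerm-positive w↭ (Matches-∈ M x∈))
                                (subst (at z x ≤_) (sym (IsPerm-length z↭)) (IsPerm-≤ w↭ (Matches-∈ M x∈))) ⟩
    at z x                 ∎))
    where
    x∈ = IsPerm-∈ w↭ 1≤x x≤m
  star≡ : star k z ≡ map (swapNum k) (swapAt k z)
  star≡ with IsPerm-side b (↭-trans (swapAt-↭ k z) z↭)
  ... | ascent e′ _ _  = trans (cong (up k) (demR-ascent i {z} k<len (f M))) e′
  -- The relabelled images keep their order, since the pair excluded in `swapNum-mono` would make
  -- `k` a fixed point. So the left action is not idle either.
  ... | descent _ _ lt′ = contradiction lt′ (<-asym (subst₂ _<_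
    (sym (pos≡at (s≤s z≤n) (<⇒≤ k<m))) (sym (pos≡at (s≤s z≤n) k<m))
    (swapNum-mono k (f M) λ e′ → contradiction e′ (Matches-fixedPointFree C′ M (IsPerm-∈ w↭ (s≤s z≤n) (<⇒≤ k<m))))))

Canon-Atom : ∀ {n x v} → Canon v → Atom n x v → Matches x v
Canon-Atom {n} C (ks , r , refl) = Canon-Matches {n} (proj₁ r) (reduced⇒ascending r) C

Canon-head-≤ : ∀ {a b l x} → Canon (a ∷ b ∷ l) → x ∈ a ∷ b ∷ l → a ≤ x
Canon-head-≤ _              (here refl)         = ≤-refl
Canon-head-≤ ((lt , _) ∷ _) (there (here refl)) = <⇒≤ lt
Canon-head-≤ ((_ , h) ∷ _)  (there (there x∈))  = <⇒≤ (All.lookup h x∈)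

-- The head is the least entry, hence common to both lists, and the second entry is its image under
-- `x`.
Canon-unique : ∀ {x c c′} → Canon c → Canon c′ → Matches x c → Matches x c′ → c ↭ c′ → c ≡ c′
Canon-unique [] [] _ _ _ = refl
Canon-unique [] (_ ∷ _) _ _ p = contradiction (↭-length p) λ ()
Canon-unique (_ ∷ _) [] _ _ p = contradiction (↭-length p) λ ()
Canon-unique C@(_ ∷ C₁) C′@(_ ∷ C₁′) ((e , _) ∷ M) ((e′ , _) ∷ M′) p
  with ≤-antisym (Canon-head-≤ C (∈-resp-↭ (↭-sym p) (here refl))) (Canon-head-≤ C′ (∈-resp-↭ p (here refl)))
... | refl with trans (sym e) e′
...   | refl = cong (λ l → _ ∷ _ ∷ l) (Canon-unique C₁ C₁′ M M′ (drop-∷ (drop-∷ p)))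

All-delete : ∀ {P : ℕ → Set} xs {b ys} → All P (xs ++ b ∷ ys) → All P (xs ++ ys)
All-delete []       (_ ∷ h) = h
All-delete (x ∷ xs) (p ∷ h) = p ∷ All-delete xs h

AllPairs-delete : ∀ {R : ℕ → ℕ → Set} xs {b ys} → AllPairs R (xs ++ b ∷ ys) → AllPairs R (xs ++ ys)
AllPairs-delete []       (_ ∷ h) = h
AllPairs-delete (x ∷ xs) (p ∷ h) = All-delete xs p ∷ AllPairs-delete xs h

-- The least remaining entry is paired with its image, and both are removed. The rest is stable
-- because the action is injective there. `N` bounds the length, as deleting the partner is not a
-- structural step.
Canon-exists : ∀ {x} N L → length L ≤ N → AllPairs _<_ L →
               (∀ {y} → y ∈ L → at x y ∈ L × at x (at x y) ≡ y × at x y ≢ y) →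
               Σ (List ℕ) λ c → Canon c × Matches x c × c ↭ L
Canon-exists N [] _ _ _ = [] , [] , [] , ↭-refl
Canon-exists {x} (suc N) (a ∷ L) (s≤s le) (a< ∷ incr) h with h (here refl)
... | b∈ , involutive , b≢a with ∈-∃++ (∈-tail b∈ (b≢a ∘ sym))
... | xs , ys , refl with Canon-exists {x} N (xs ++ ys)
        (≤-trans (≤-trans (n≤1+n _) (≤-reflexive (sym (↭-length (shift (at x a) xs ys))))) le)
        (AllPairs-delete xs incr) closed
  where
  b = at x a
  L↭ = shift b xs ys
  unique-b = Unique-resp-↭ L↭ (AllPairs.map <⇒≢ incr)
  closed : ∀ {y} → y ∈ xs ++ ys → at x y ∈ xs ++ ys × at x (at x y) ≡ y × at x y ≢ y
  closed {y} y∈ with h (there (∈-resp-↭ (↭-sym L↭) (there y∈)))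
  ... | xy∈ , inv-y , ne = ∈-tail (∈-resp-↭ L↭ (∈-tail xy∈ a≢xy)) b≢xy , inv-y , ne
    where
    a≢xy : a ≢ at x y
    a≢xy e = All.lookup (AllPairs.head unique-b) y∈ (trans (cong (at x) e) inv-y)
    b≢xy : b ≢ at x y
    b≢xy e = <⇒≢ (All.lookup (All-delete xs a<) y∈) (trans (sym involutive) (trans (cong (at x) e) inv-y))
... | c , C , M , c↭ = a ∷ at x a ∷ c ,
  (All.lookup a< (∈-tail b∈ (b≢a ∘ sym)) , All-resp-↭ (↭-sym c↭) (All-delete xs a<)) ∷ C ,
  (refl , involutive) ∷ M ,
  prep a (↭-trans (prep (at x a) c↭) (↭-sym (shift (at x a) xs ys)))

FPFInvolution-Canon : ∀ {n x} → FPFInvolution n x → Σ (List ℕ) λ c → Canon c × Matches x c × IsPerm (2 * n) c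
FPFInvolution-Canon {n} {x} (x↭ , x·x , fpf)
  with Canon-exists {x} (2 * n) (from 0 (2 * n)) (≤-reflexive (length-from 0 (2 * n))) (from-increasing 0 (2 * n)) closed
  where
  closed : ∀ {y} → y ∈ from 0 (2 * n) → at x y ∈ from 0 (2 * n) × at x (at x y) ≡ y × at x y ≢ y
  closed {y} y∈ = subst (at x y ∈_) (oneTo≡from (2 * n)) (∈-resp-↭ x↭ (at-∈ 1≤y y≤len)) ,
    trans (sym (at-map (at x) {x} 1≤y y≤len)) (trans (cong (λ l → at l y) x·x) (at-oneTo 1≤y y≤m)) , fpf y 1≤y y≤m
    where
    1≤y = All.lookup (from-> 0 (2 * n)) y∈
    y≤m = All.lookup (from-≤ 0 (2 * n)) y∈
    y≤len = subst (y ≤_) (sym (IsPerm-length x↭)) y≤m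
... | c , C , M , c↭ = c , C , M , ↭-trans c↭ (↭-reflexive (sym (oneTo≡from (2 * n))))

Canon-FPFInvolution : ∀ {n x c} → IsPerm (2 * n) x → IsPerm (2 * n) c → Canon c → Matches x c → FPFInvolution n x
Canon-FPFInvolution {n} {x} {c} x↭ c↭ C M = x↭ ,
  list-ext (trans (length-map (at x) x) (trans (IsPerm-length x↭) (sym (length-oneTo (2 * n))))) (λ j 1≤j j≤ →
    let j≤len = subst (j ≤_) (length-map (at x) x) j≤
        j≤m   = subst (j ≤_) (IsPerm-length x↭) j≤len in
    trans (at-map (at x) {x} 1≤j j≤len)
      (trans (Matches-involutive M (IsPerm-∈ c↭ 1≤j j≤m)) (sym (at-oneTo 1≤j j≤m)))) ,
  λ j 1≤j j≤m → Matches-fixedPointFree C M (IsPerm-∈ c↭ 1≤j j≤m)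

-- Involutions as values, and the classes

Matches-unique : ∀ {m x z c} → IsPerm m x → IsPerm m z → IsPerm m c → Matches x c → Matches z c → x ≡ z
Matches-unique x↭ z↭ c↭ M M′ = list-ext (trans (IsPerm-length x↭) (sym (IsPerm-length z↭))) λ j 1≤j j≤len →
  Matches-agree M M′ (IsPerm-∈ c↭ 1≤j (subst (j ≤_) (IsPerm-length x↭) j≤len))

IsPerm-canonical : ∀ {n v} → IsPerm (2 * n) v → Canonical v
IsPerm-canonical {n} v↭ = canonical n (IsPerm-length v↭) (IsPerm-Unique v↭)

-- No word is fitted to `x`: along any reduced word of `c` the value exchanges the same pairs as
-- `x`, so it is `x`.
Matches⇒Atom : ∀ {n x c} → IsPerm (2 * n) x → IsPerm (2 * n) c → Canon c → Matches x c → Atom n x c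
Matches⇒Atom {n} x↭ c↭ C M with reducedWord c↭
... | ks , r = ks , r , Matches-unique (stars-IsPerm (proj₁ r) (wfpf-IsPerm n)) x↭ c↭ (Canon-Atom {n} C (ks , r , refl)) M

Atom-canonical : ∀ {n x v} → IsPerm (2 * n) v → Atom n x v →
                 Σ (List ℕ) λ c → Canon c × IsPerm (2 * n) c × Matches x c × seq v ∼B seq c
Atom-canonical {n} v↭ at with IsPerm-canonical {n} v↭
... | c , C , c↭ , ∼c = c , C , ↭-trans c↭ v↭ , Canon-Atom {n} C (Atom-∼B {n} ∼c v↭ at) , ∼c

Atoms-∼B : ∀ {n x u v} → IsPerm (2 * n) u → IsPerm (2 * n) v → Atom n x u → Atom n x v → seq u ∼B seq v
Atoms-∼B {n} {u = u} u↭ v↭ at at′ with Atom-canonical {n} u↭ at | Atom-canonical {n} v↭ at′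
... | c , C , c↭ , M , ∼c | c′ , C′ , c′↭ , M′ , ∼c′ =
  subst (λ z → seq u ∼B seq z) (Canon-unique C C′ M M′ (↭-trans c↭ (↭-sym c′↭))) ∼c ◅◅ symmetric Step ∼c′

theorem6p20 : (n : ℕ) →
    ((x : List ℕ) → FPFInvolution n x →
    Σ (List ℕ) (λ u → BFPF n x u)
    × ((u v : List ℕ) → BFPF n x u → BFPF n x v → seq (inv u) ∼B seq (inv v))
    × ((u w : List ℕ) → BFPF n x u → IsPerm (2 * n) w → seq (inv u) ∼B seq w →
    BFPF n x (inv w)))
    × ((w : List ℕ) → IsPerm (2 * n) w →
    Σ (List ℕ) (λ x → FPFInvolution n x × BFPF n x (inv w)))
theorem6p20 n = class , exhaustive
  where
  class : (x : List ℕ) → FPFInvolution n x →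
    Σ (List ℕ) (λ u → BFPF n x u)
    × ((u v : List ℕ) → BFPF n x u → BFPF n x v → seq (inv u) ∼B seq (inv v))
    × ((u w : List ℕ) → BFPF n x u → IsPerm (2 * n) w → seq (inv u) ∼B seq w → BFPF n x (inv w))
  class x x-fpf@(x↭ , _) with FPFInvolution-Canon {n} x-fpf
  ... | c , C , M , c↭ =
    (inv c , Atom⇒BFPF {n} c↭ (Matches⇒Atom {n} x↭ c↭ C M)) ,
    (λ u v Bu Bv → Atoms-∼B {n} (inv-IsPerm (proj₁ Bu)) (inv-IsPerm (proj₁ Bv)) (BFPF⇒Atom {n} Bu) (BFPF⇒Atom {n} Bv)) ,
    (λ u w Bu w↭ u∼w → Atom⇒BFPF {n} w↭ (Atom-∼B {n} u∼w (inv-IsPerm (proj₁ Bu)) (BFPF⇒Atom {n} Bu)))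

  exhaustive : (w : List ℕ) → IsPerm (2 * n) w → Σ (List ℕ) (λ x → FPFInvolution n x × BFPF n x (inv w))
  -- Any reduced word of `w` provides the candidate involution; its properties are read off the
  -- canonical representative, which has the same value.
  exhaustive w w↭ with reducedWord w↭
  ... | ks , r with Atom-canonical {n} w↭ (ks , r , refl)
  ...   | c , C , c↭ , M , _ = stars ks (wfpf n) ,
    Canon-FPFInvolution {n} (stars-IsPerm (proj₁ r) (wfpf-IsPerm n)) c↭ C M ,
    Atom⇒BFPF {n} w↭ (ks , r , refl)
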